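{- Let $A$ be a countable set, $\diamond$ a commutative associative product on $\mathbb{Q}A$, and $r\in\mathbb{Q}$. If $u_1,\dots,u_n\in A$, then in $(\mathbb{Q}\langle A\rangle,\overset{r}{*})$ \[ \sum_{\sigma\in S_n}u_{\sigma(1)}u_{\sigma(2)}\cdots u_{\sigma(n)}=\sum_{B=\{B_1,\dots,B_l\}\in\Pi_n}c_r(B)\,u_{B_1}\overset{r}{*}u_{B_2}\overset{r}{*}\cdots\overset{r}{*}u_{B_l}, \] where $S_n$ is the symmetric group, $\Pi_n$ is the set of partitions of $\{1,\dots,n\}$ into nonempty blocks, $u_{B_i}=\diamond_{j\in B_i}u_j$, $p_a(r)=(1-r)^a-(-r)^a$, and \[ c_r(B)=(-1)^{n-l}\prod_{m=1}^l(\operatorname{card}B_m-1)!\,p_{\operatorname{card}B_m}(r). \]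
   Context: $\mathbb{Q}\langle A\rangle$ is the algebra of words in $A$ (concatenation, expanding elements of $\mathbb{Q}A$ linearly). The quasi-shuffle product $*$: $1*w=w*1=w$, $(aw)*(bv)=a(w*bv)+b(aw*v)+(a\diamond b)(w*v)$ for letters $a,b$. For a composition $I=(i_1,\dots,i_m)$ of $N$ and a word $w=a_1\cdots a_N$, $I[w]=(a_1\diamond\cdots\diamond a_{i_1})\cdots(a_{i_1+\dots+i_{m-1}+1}\diamond\cdots\diamond a_N)$. For $s\in\mathbb{Q}$, $\Sigma^s(w)=\sum_I s^{N-m}I[w]$ over compositions $I$ of $N=\ell(w)$ with $m$ parts; $\Sigma^{ -r}$ is inverse to $\Sigma^r$; the interpolated product is $u\overset{r}{*}v=\Sigma^{ -r}(\Sigma^ru*\Sigma^rv)$, extended bilinearly. -}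

module Defs where

open import Data.Nat as ℕ using (ℕ; zero; suc; _∸_; _!)
open import Data.Integer using (+_)
open import Data.Rational using (ℚ; 0ℚ; 1ℚ; _+_; _*_; _-_; -_; _/_)
open import Data.Fin using (Fin)
open import Data.List as List using (List; []; _∷_; _++_; map; concatMap; filter; foldr; length; allFin)
open import Data.List.NonEmpty as List⁺ using (List⁺; _∷_)
open import Data.List.Properties using (≡-dec)
import Data.List.Relation.Unary.Unique.DecPropositional as UniqueDec
open import Data.Vec as Vec using (Vec; []; _∷_; toList)
open import Data.Product using (_×_; _,_)
open import Relation.Nullary using (yes; no)
open import Relation.Binary.Definitions using (DecidableEquality)
open import Relation.Binary.PropositionalEquality using (_≡_; cong)
open import Function.Definitions using (Injective)

countableDec : {A : Set} (enc : A → ℕ) → Injective _≡_ _≡_ enc → DecidableEquality A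
countableDec enc inj a b with enc a ℕ.≟ enc b
... | yes p = yes (inj p)
... | no ¬p = no (λ e → ¬p (cong enc e))

-- Finite formal ℚ-linear combinations  ℚX  (as lists of terms),
-- compared by their coefficient functions.

Lin : Set → Set
Lin X = List (ℚ × X)

scale : {X : Set} → ℚ → Lin X → Lin X
scale c = map (λ { (d , x) → (c * d , x) })

coeff : {X : Set} → DecidableEquality X → Lin X → X → ℚ
coeff _≟_ [] x = 0ℚ
coeff _≟_ ((c , y) ∷ p) x with y ≟ x
... | yes _ = c + coeff _≟_ p x
... | no  _ = coeff _≟_ p x

_≈⟨_⟩_ : {X : Set} → Lin X → DecidableEquality X → Lin X → Set
p ≈⟨ d ⟩ q = ∀ x → coeff d p x ≡ coeff d q x

infix 4 _≈⟨_⟩_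

_^ℚ_ : ℚ → ℕ → ℚ
q ^ℚ zero  = 1ℚ
q ^ℚ suc n = q * (q ^ℚ n)

ℕtoℚ : ℕ → ℚ
ℕtoℚ n = + n / 1

module Ops {A : Set} (_⋄_ : A → A → Lin A) where

  Word : Set
  Word = List A

  Poly : Set
  Poly = Lin Word

  _⋄ₗ_ : Lin A → Lin A → Lin A
  p ⋄ₗ q = concatMap (λ { (c , a) → concatMap (λ { (d , b) → scale (c * d) (a ⋄ b) }) q }) p

  letter : A → Lin A
  letter a = (1ℚ , a) ∷ []

  letterPoly : Lin A → Poly
  letterPoly = map (λ { (c , a) → (c , a ∷ []) })

  one : Poly
  one = (1ℚ , []) ∷ []

  _·_ : Poly → Poly → Poly
  p · q = concatMap (λ { (c , w) → map (λ { (d , v) → (c * d , w ++ v) }) q }) p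

  _⊛_ : Word → Word → Poly
  [] ⊛ v = (1ℚ , v) ∷ []
  (a ∷ w) ⊛ [] = (1ℚ , a ∷ w) ∷ []
  (a ∷ w) ⊛ (b ∷ v) =
      (letterPoly (letter a) · (w ⊛ (b ∷ v)))
   ++ (letterPoly (letter b) · ((a ∷ w) ⊛ v))
   ++ (letterPoly (a ⋄ b) · (w ⊛ v))

  _⊛ₚ_ : Poly → Poly → Poly
  p ⊛ₚ q = concatMap (λ { (c , w) → concatMap (λ { (d , v) → scale (c * d) (w ⊛ v) }) q }) p

  dia : List⁺ A → Lin A
  dia (a ∷ as) = List.foldl (λ acc b → acc ⋄ₗ letter b) (letter a) as

  -- all ways to cut a word into nonempty consecutive blocks
  -- (these correspond exactly to the compositions I of ℓ(w))
  segs : Word → List (List (List⁺ A))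
  segs [] = [] ∷ []
  segs (a ∷ w) = concatMap step (segs w)
    where
    step : List (List⁺ A) → List (List (List⁺ A))
    step [] = ((a ∷ []) ∷ []) ∷ []
    step (B ∷ S) = ((a ∷ []) ∷ B ∷ S) ∷ ((a ∷ List⁺.toList B) ∷ S) ∷ []

  evalSeg : List (List⁺ A) → Poly
  evalSeg S = foldr (λ B acc → letterPoly (dia B) · acc) one S

  Σ^ : ℚ → Word → Poly
  Σ^ s w = concatMap (λ S → scale (s ^ℚ (length w ∸ length S)) (evalSeg S)) (segs w)

  Σ^ₚ : ℚ → Poly → Poly
  Σ^ₚ s p = concatMap (λ { (c , w) → scale c (Σ^ s w) }) p

  interp : ℚ → Poly → Poly → Poly
  interp r u v = Σ^ₚ (- r) (Σ^ₚ r u ⊛ₚ Σ^ₚ r v)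

  interpProd : ℚ → List Poly → Poly
  interpProd r [] = one
  interpProd r (x ∷ []) = x
  interpProd r (x ∷ y ∷ xs) = interp r x (interpProd r (y ∷ xs))

-- Symmetric group S_n: all bijections Fin n → Fin n, listed as the
-- vectors (σ(1),…,σ(n)) with pairwise distinct entries.

allVecs : (n k : ℕ) → List (Vec (Fin n) k)
allVecs n zero = [] ∷ []
allVecs n (suc k) = concatMap (λ i → map (i ∷_) (allVecs n k)) (allFin n)

Sym : (n : ℕ) → List (Vec (Fin n) n)
Sym n = filter (λ σ → UniqueDec.unique? Data.Fin._≟_ (toList σ)) (allVecs n n)

-- Set partitions Π of a list of distinct elements into nonempty blocks
-- (each partition listed once: the first element either forms a new
-- block or is inserted into one existing block).
inserts : {X : Set} → X → List (List⁺ X) → List (List (List⁺ X))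
inserts x [] = []
inserts x (B ∷ P) = ((x ∷ List⁺.toList B) ∷ P) ∷ map (B ∷_) (inserts x P)

partitions : {X : Set} → List X → List (List (List⁺ X))
partitions [] = [] ∷ []
partitions (x ∷ xs) = concatMap (λ P → ((x ∷ []) ∷ P) ∷ inserts x P) (partitions xs)

Π : (n : ℕ) → List (List (List⁺ (Fin n)))
Π n = partitions (allFin n)

pPoly : ℕ → ℚ → ℚ
pPoly a r = ((1ℚ - r) ^ℚ a) - ((- r) ^ℚ a)

cr : ℚ → (n : ℕ) → List (List⁺ (Fin n)) → ℚ
cr r n B = ((- 1ℚ) ^ℚ (n ∸ length B))
         * foldr (λ Bm acc → ℕtoℚ ((List⁺.length Bm ∸ 1) !) * pPoly (List⁺.length Bm) r * acc) 1ℚ B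

module Sides {A : Set} (_⋄_ : A → A → Lin A) (r : ℚ) (n : ℕ) (u : Fin n → A) where
  open Ops _⋄_

  lhs : Poly
  lhs = map (λ σ → (1ℚ , map u (toList σ))) (Sym n)

  uB : List⁺ (Fin n) → Poly
  uB B = letterPoly (dia (List⁺.map u B))

  rhs : Poly
  rhs = concatMap (λ B → scale (cr r n B) (interpProd r (map uB B))) (Π n)

{-# OPTIONS --safe #-}
module Submission where

-- Let G(S) be Σ^r of the sum of all permutations of the word S, and L(x;S) the part of
-- G(xS) in which x is the last letter of its block. With y ranging over the letters of S,
--   G(xS)  = L(x;S) + r Σ_y G((x⋄y)(S∖y)),
--   L(x;S) = x * G(S) + (r − 1) Σ_y L(x⋄y; S∖y).
-- The sums K_s(x;S) = Σ_{T⊆S} |T|! s^|T| (x⋄⋄T) * G(S∖T), where x⋄⋄T is the ⋄-product of x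
-- and T, satisfy K_s(x;S) = x * G(S) + s Σ_y K_s(x⋄y; S∖y), so that L = K_{r−1} and
-- G(xS) = r K_r(x;S) − (r − 1) K_{r−1}(x;S). Since (−1)^(b−1) p_b(r) = r^b − (r−1)^b, this is
-- also what splitting off the block of x from the sum over set partitions gives, and both
-- sides agree by induction once Σ^r and Σ^(−r) are known to be mutually inverse.

open import Defs
open import Data.Nat as ℕ using (ℕ; zero; suc; _∸_; _!; z≤n; s≤s)
import Data.Nat.Properties as ℕ
import Data.Integer as ℤ
import Data.Integer.Properties as ℤ
open import Data.Rational using (ℚ; 0ℚ; 1ℚ; _+_; _*_; _-_; -_; toℚᵘ)
open import Data.Rational.Properties
  using ( +-assoc; +-comm; +-identityˡ; +-identityʳ; +-inverseˡ; +-inverseʳ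
        ; *-assoc; *-comm; *-identityˡ; *-identityʳ; *-zeroˡ; *-zeroʳ; *-distribˡ-+
        ; toℚᵘ-injective; toℚᵘ-fromℚᵘ; toℚᵘ-homo-+; toℚᵘ-homo-* )
open import Data.Rational.Unnormalised as ℚᵘ using (mkℚᵘ; *≡*)
import Data.Rational.Unnormalised.Properties as ℚᵘ
open import Data.Rational.Solver using (module +-*-Solver)
open +-*-Solver using (solve; _:=_; _:+_; _:*_; _:-_; :-_; con)
open import Data.Fin as Fin using (Fin)
open import Data.Vec using (Vec; _∷_; toList)
open import Data.List
  using (List; []; _∷_; _++_; map; concatMap; filter; foldl; foldr; length; allFin)
open import Data.List.Properties
  using (≡-dec; filter-accept; filter-all; filter-reject; length-map; length-tabulate; map-∘)
open import Data.List.NonEmpty as List⁺ using (List⁺; _∷_)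
open import Data.List.Membership.Propositional using (_∈_; _∉_)
open import Data.List.Membership.Propositional.Properties
  using (∈-++⁺ˡ; ∈-++⁺ʳ; ∈-map⁺; ∈-filter⁺; ∈-filter⁻; ∈-allFin)
open import Data.List.Relation.Unary.All as All using (All; []; _∷_)
import Data.List.Relation.Unary.All.Properties as All
open import Data.List.Relation.Unary.AllPairs using ([]; _∷_)
open import Data.List.Relation.Unary.Any using (here; there)
open import Data.List.Relation.Unary.Unique.Propositional using (Unique)
import Data.List.Relation.Unary.Unique.Propositional.Properties as Unique
import Data.List.Relation.Unary.Unique.DecPropositional as UniqueDec
open import Data.Product using (_×_; _,_; proj₁; proj₂; map₁; map₂)
open import Function.Definitions using (Injective)
open import Relation.Nullary using (Dec; yes; no; ¬_; ¬?; contradiction)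
open import Relation.Binary.Definitions using (DecidableEquality)
open import Relation.Binary.PropositionalEquality
  using (_≡_; _≢_; refl; sym; ≢-sym; trans; cong; cong₂; module ≡-Reasoning)
open ≡-Reasoning

-- A list of terms has many forms, so an element of ℚX is compared through its values on test
-- functions `g`. Every linear operator then appears as its transpose, acting on `g`, and nested
-- transposes compose in reverse order. `Σ^ r` turns the interpolated product into the ordinary
-- quasi-shuffle product; on that side r enters only through scalar weights. Why the last letter of
-- a block: each block has exactly one. Absorbing x into a block of Σ^r(w) therefore amounts to
-- replacing one letter y of w, the last of that block, by x⋄y, so summing over all letters of w
-- counts each absorption once. Absorption has weight r in Σ^r and weight 1 in x * G(S), which is
-- where r - 1 comes from. Let P send Φ to the sum of Φ(x⋄y; S without y) over y. With Φ(x; S) = x *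
-- G(S), K_s is (1 - sP)^(-1) Φ, and the formula for G is the partial fraction expansion of (1 -
-- rP)^(-1) (1 - (r-1)P)^(-1). Since x⋄y is a linear combination and S without y is not a tail of S,
-- statements hold for all x and `g`, and inductions run over lengths.

private variable
  X Y : Set

+-interchange : ∀ a b c d → (a + b) + (c + d) ≡ (a + c) + (b + d)
+-interchange = solve 4 (λ a b c d → (a :+ b) :+ (c :+ d) := (a :+ c) :+ (b :+ d)) refl

*-exchange : ∀ a b c → a * (b * c) ≡ b * (a * c)
*-exchange = solve 3 (λ a b c → a :* (b :* c) := b :* (a :* c)) refl

-- Finite sums and test functions

∑ : List X → (X → ℚ) → ℚ
∑ []      f = 0ℚ
∑ (x ∷ L) f = f x + ∑ L f

∑-cong-All : ∀ (L : List X) {f g} → All (λ x → f x ≡ g x) L → ∑ L f ≡ ∑ L g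
∑-cong-All []      []       = refl
∑-cong-All (x ∷ L) (e ∷ es) = cong₂ _+_ e (∑-cong-All L es)

∑-cong : ∀ (L : List X) {f g} → (∀ x → f x ≡ g x) → ∑ L f ≡ ∑ L g
∑-cong L e = ∑-cong-All L (All.universal e L)

∑-+ : ∀ (L : List X) f g → ∑ L (λ x → f x + g x) ≡ ∑ L f + ∑ L g
∑-+ []      f g = refl
∑-+ (x ∷ L) f g = trans (cong (f x + g x +_) (∑-+ L f g)) (+-interchange (f x) (g x) _ _)

∑-* : ∀ (L : List X) c f → ∑ L (λ x → c * f x) ≡ c * ∑ L f
∑-* []      c f = sym (*-zeroʳ c)
∑-* (x ∷ L) c f = trans (cong (c * f x +_) (∑-* L c f)) (sym (*-distribˡ-+ c (f x) _))

∑-0 : ∀ (L : List X) → ∑ L (λ _ → 0ℚ) ≡ 0ℚ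
∑-0 []      = refl
∑-0 (x ∷ L) = trans (+-identityˡ _) (∑-0 L)

∑-++ : ∀ (L M : List X) f → ∑ (L ++ M) f ≡ ∑ L f + ∑ M f
∑-++ []      M f = sym (+-identityˡ _)
∑-++ (x ∷ L) M f = trans (cong (f x +_) (∑-++ L M f)) (sym (+-assoc (f x) _ _))

∑-map : ∀ (h : X → Y) L f → ∑ (map h L) f ≡ ∑ L (λ x → f (h x))
∑-map h []      f = refl
∑-map h (x ∷ L) f = cong (f (h x) +_) (∑-map h L f)

∑-concatMap : ∀ (h : X → List Y) L f → ∑ (concatMap h L) f ≡ ∑ L (λ x → ∑ (h x) f)
∑-concatMap h []      f = refl
∑-concatMap h (x ∷ L) f = trans (∑-++ (h x) _ f) (cong (∑ (h x) f +_) (∑-concatMap h L f))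

∑-swap : ∀ (L : List X) (M : List Y) (f : X → Y → ℚ) →
  ∑ L (λ x → ∑ M (f x)) ≡ ∑ M (λ y → ∑ L (λ x → f x y))
∑-swap []      M f = sym (∑-0 M)
∑-swap (x ∷ L) M f =
  trans (cong (∑ M (f x) +_) (∑-swap L M f)) (sym (∑-+ M (f x) _))

-- An element of ℚX is identified with the functional it induces on all functions X → ℚ;
-- identities in ℚX are proved by evaluating both sides at an arbitrary function.
⟦_⟧ : Lin X → (X → ℚ) → ℚ
⟦ p ⟧ f = ∑ p (λ (c , x) → c * f x)

⟦⟧-cong : ∀ (p : Lin X) {f g} → (∀ x → f x ≡ g x) → ⟦ p ⟧ f ≡ ⟦ p ⟧ g
⟦⟧-cong p e = ∑-cong p (λ (c , x) → cong (c *_) (e x))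

⟦⟧-+ : ∀ (p : Lin X) f g → ⟦ p ⟧ (λ x → f x + g x) ≡ ⟦ p ⟧ f + ⟦ p ⟧ g
⟦⟧-+ p f g = trans (∑-cong p (λ (c , x) → *-distribˡ-+ c (f x) (g x))) (∑-+ p _ _)

⟦⟧-* : ∀ (p : Lin X) c f → ⟦ p ⟧ (λ x → c * f x) ≡ c * ⟦ p ⟧ f
⟦⟧-* p c f = trans (∑-cong p (λ (d , x) → *-exchange d c (f x))) (∑-* p c _)

⟦⟧-0 : ∀ (p : Lin X) → ⟦ p ⟧ (λ _ → 0ℚ) ≡ 0ℚ
⟦⟧-0 p = trans (∑-cong p (λ (c , _) → *-zeroʳ c)) (∑-0 p)

⟦⟧-∑ : ∀ (p : Lin X) (L : List Y) (f : X → Y → ℚ) →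
  ⟦ p ⟧ (λ x → ∑ L (f x)) ≡ ∑ L (λ y → ⟦ p ⟧ (λ x → f x y))
⟦⟧-∑ p L f = trans (∑-cong p (λ (c , x) → sym (∑-* L c (f x)))) (∑-swap p L _)

⟦⟧-swap : ∀ (p : Lin X) (q : Lin Y) (f : X → Y → ℚ) →
  ⟦ p ⟧ (λ x → ⟦ q ⟧ (f x)) ≡ ⟦ q ⟧ (λ y → ⟦ p ⟧ (λ x → f x y))
⟦⟧-swap p q f = trans (⟦⟧-∑ p q _) (∑-cong q (λ (d , y) → ⟦⟧-* p d (λ x → f x y)))

⟦⟧-scale : ∀ c (p : Lin X) f → ⟦ scale c p ⟧ f ≡ c * ⟦ p ⟧ f
⟦⟧-scale c p f =
  trans (∑-map _ p _) (trans (∑-cong p (λ (d , x) → *-assoc c d (f x))) (∑-* p c _))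

⟦⟧-++ : ∀ (p q : Lin X) f → ⟦ p ++ q ⟧ f ≡ ⟦ p ⟧ f + ⟦ q ⟧ f
⟦⟧-++ p q f = ∑-++ p q _

⟦⟧-concatMap : ∀ (k : ℚ × X → Lin Y) (p : Lin X) f g →
  (∀ c x → ⟦ k (c , x) ⟧ g ≡ c * f x) → ⟦ concatMap k p ⟧ g ≡ ⟦ p ⟧ f
⟦⟧-concatMap k p f g e = trans (∑-concatMap k p _) (∑-cong p (λ (c , x) → e c x))

-- Equality of coefficients and equality of functionals

module _ {X : Set} (_≟_ : DecidableEquality X) where

  open import Data.List.Membership.DecPropositional _≟_ using (_∈?_)

  δ : X → X → ℚ
  δ x y with y ≟ x
  ... | yes _ = 1ℚ
  ... | no  _ = 0ℚ

  δ-≡ : ∀ x → δ x x ≡ 1ℚ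
  δ-≡ x with x ≟ x
  ... | yes _ = refl
  ... | no ¬e = contradiction refl ¬e

  coeff≡⟦⟧δ : ∀ p x → coeff _≟_ p x ≡ ⟦ p ⟧ (δ x)
  coeff≡⟦⟧δ []            x = refl
  coeff≡⟦⟧δ ((c , y) ∷ p) x with y ≟ x
  ... | yes _ = cong₂ _+_ (sym (*-identityʳ c)) (coeff≡⟦⟧δ p x)
  ... | no  _ = trans (coeff≡⟦⟧δ p x)
                  (sym (trans (cong (_+ ⟦ p ⟧ (δ x)) (*-zeroʳ c)) (+-identityˡ _)))

  ⟦⟧⇒≈ : ∀ p q → (∀ g → ⟦ p ⟧ g ≡ ⟦ q ⟧ g) → p ≈⟨ _≟_ ⟩ q
  ⟦⟧⇒≈ p q e x = trans (coeff≡⟦⟧δ p x) (trans (e (δ x)) (sym (coeff≡⟦⟧δ q x)))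

  private
    off : X → (X → ℚ) → X → ℚ
    off y g x with x ≟ y
    ... | yes _ = 0ℚ
    ... | no  _ = g x

    split-δ : ∀ y g x → g x ≡ g y * δ y x + off y g x
    split-δ y g x with x ≟ y
    ... | yes refl = sym (trans (+-identityʳ _) (*-identityʳ (g x)))
    ... | no  _    = sym (trans (cong (_+ g x) (*-zeroʳ (g y))) (+-identityˡ (g x)))

    off-∉ : ∀ y g L → (∀ x → x ∉ y ∷ L → g x ≡ 0ℚ) → ∀ x → x ∉ L → off y g x ≡ 0ℚ
    off-∉ y g L g∉ x x∉L with x ≟ y
    ... | yes _  = refl
    ... | no x≢y = g∉ x λ { (here e) → x≢y e ; (there m) → x∉L m }

    ⟦⟧-split-δ : ∀ p y g → ⟦ p ⟧ g ≡ g y * coeff _≟_ p y + ⟦ p ⟧ (off y g)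
    ⟦⟧-split-δ p y g = begin
      ⟦ p ⟧ g                                      ≡⟨ ⟦⟧-cong p (split-δ y g) ⟩
      ⟦ p ⟧ (λ x → g y * δ y x + off y g x)        ≡⟨ ⟦⟧-+ p _ _ ⟩
      ⟦ p ⟧ (λ x → g y * δ y x) + ⟦ p ⟧ (off y g)  ≡⟨ cong (_+ ⟦ p ⟧ (off y g)) (⟦⟧-* p (g y) (δ y)) ⟩
      g y * ⟦ p ⟧ (δ y) + ⟦ p ⟧ (off y g)          ≡⟨ cong (λ z → g y * z + ⟦ p ⟧ (off y g)) (coeff≡⟦⟧δ p y) ⟨
      g y * coeff _≟_ p y + ⟦ p ⟧ (off y g)        ∎

    -- Removing one point `y` from the support splits off `g y` times the coefficient at `y`, on
    -- which `p` and `q` agree; once nothing is left, both functionals vanish.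
    ≈⇒⟦⟧-supported : ∀ p q → p ≈⟨ _≟_ ⟩ q →
      ∀ L g → (∀ x → x ∉ L → g x ≡ 0ℚ) → ⟦ p ⟧ g ≡ ⟦ q ⟧ g
    ≈⇒⟦⟧-supported p q p≈q [] g g∉ =
      trans (vanish p) (sym (vanish q))
      where
      vanish : ∀ s → ⟦ s ⟧ g ≡ 0ℚ
      vanish s = trans (⟦⟧-cong s (λ x → g∉ x λ ())) (⟦⟧-0 s)
    ≈⇒⟦⟧-supported p q p≈q (y ∷ L) g g∉ = begin
      ⟦ p ⟧ g                                ≡⟨ ⟦⟧-split-δ p y g ⟩
      g y * coeff _≟_ p y + ⟦ p ⟧ (off y g)  ≡⟨ cong₂ (λ c d → g y * c + d) (p≈q y)
                                                  (≈⇒⟦⟧-supported p q p≈q L (off y g) (off-∉ y g L g∉)) ⟩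
      g y * coeff _≟_ q y + ⟦ q ⟧ (off y g)  ≡⟨ ⟦⟧-split-δ q y g ⟨
      ⟦ q ⟧ g                                ∎

    _↾_ : (X → ℚ) → List X → X → ℚ
    (g ↾ L) x with x ∈? L
    ... | yes _ = g x
    ... | no  _ = 0ℚ

    ↾-∈ : ∀ g L {x} → x ∈ L → g x ≡ (g ↾ L) x
    ↾-∈ g L {x} m with x ∈? L
    ... | yes _ = refl
    ... | no x∉ = contradiction m x∉

    ↾-∉ : ∀ g L x → x ∉ L → (g ↾ L) x ≡ 0ℚ
    ↾-∉ g L x x∉ with x ∈? L
    ... | yes m = contradiction m x∉
    ... | no  _ = refl

  -- Only finitely many points occur in `p` and `q`, so `g` may be cut down to these without
  -- changing either value.
  ≈⇒⟦⟧ : ∀ p q → p ≈⟨ _≟_ ⟩ q → ∀ g → ⟦ p ⟧ g ≡ ⟦ q ⟧ g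
  ≈⇒⟦⟧ p q p≈q g = begin
    ⟦ p ⟧ g        ≡⟨ ∑-cong-All p (All.tabulate λ {(c , x)} m →
                        cong (c *_) (↾-∈ g L (∈-++⁺ˡ (∈-map⁺ proj₂ m)))) ⟩
    ⟦ p ⟧ (g ↾ L)  ≡⟨ ≈⇒⟦⟧-supported p q p≈q L (g ↾ L) (↾-∉ g L) ⟩
    ⟦ q ⟧ (g ↾ L)  ≡⟨ ∑-cong-All q (All.tabulate λ {(c , x)} m →
                        cong (c *_) (↾-∈ g L (∈-++⁺ʳ (map proj₂ p) (∈-map⁺ proj₂ m)))) ⟨
    ⟦ q ⟧ g        ∎
    where
    L = map proj₂ p ++ map proj₂ q

-- Cuts, marked letters and permutations of a word

cuts : List X → List (List X × List X)
cuts []      = ([] , []) ∷ []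
cuts (a ∷ w) = ([] , a ∷ w) ∷ map (map₁ (a ∷_)) (cuts w)

places : List X → List (List X × X × List X)
places []      = []
places (a ∷ w) = ([] , a , w) ∷ map (map₁ (a ∷_)) (places w)

cuts-∷ : ∀ (a : X) w (k : List X → List X → ℚ) →
  ∑ (cuts (a ∷ w)) (λ (p , q) → k p q) ≡ k [] (a ∷ w) + ∑ (cuts w) (λ (p , q) → k (a ∷ p) q)
cuts-∷ a w k = cong (k [] (a ∷ w) +_) (∑-map (map₁ (a ∷_)) (cuts w) _)

places-∷ : ∀ (a : X) w (k : List X → X → List X → ℚ) →
  ∑ (places (a ∷ w)) (λ (p , b , q) → k p b q)
    ≡ k [] a w + ∑ (places w) (λ (p , b , q) → k (a ∷ p) b q)
places-∷ a w k = cong (k [] a w +_) (∑-map (map₁ (a ∷_)) (places w) _)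

insert : X → (List X → ℚ) → List X → ℚ
insert c g w = ∑ (cuts w) (λ (p , q) → g (p ++ c ∷ q))

insert-∷ : ∀ (c : X) g a w → insert c g (a ∷ w) ≡ g (c ∷ a ∷ w) + insert c (λ v → g (a ∷ v)) w
insert-∷ c g a w = cuts-∷ a w (λ p q → g (p ++ c ∷ q))

insert-cong : ∀ (c : X) {f g} → (∀ w → f w ≡ g w) → ∀ w → insert c f w ≡ insert c g w
insert-cong c e w = ∑-cong (cuts w) (λ (p , q) → e (p ++ c ∷ q))

insert-+ : ∀ (c : X) f g w → insert c (λ v → f v + g v) w ≡ insert c f w + insert c g w
insert-+ c f g w = ∑-+ (cuts w) _ _

-- When a word is cut after `c` has been put into it, `c` lies in exactly one of the two pieces, at
-- any position there.
insert-cuts : ∀ (c : X) w (k : List X → List X → ℚ) →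
  insert c (λ w → ∑ (cuts w) (λ (p , q) → k p q)) w
    ≡ ∑ (cuts w) (λ (p , q) → insert c (λ p → k p q) p + insert c (k p) q)
insert-cuts c [] k = solve 2 (λ x y → (x :+ (y :+ con 0ℚ)) :+ con 0ℚ :=
  ((y :+ con 0ℚ) :+ (x :+ con 0ℚ)) :+ con 0ℚ) refl (k [] (c ∷ [])) (k (c ∷ []) [])
insert-cuts c (a ∷ w) k = begin
  insert c K (a ∷ w)
    ≡⟨ insert-∷ c K a w ⟩
  K (c ∷ a ∷ w) + insert c (λ w → K (a ∷ w)) w
    ≡⟨ cong₂ _+_
         (trans (cuts-∷ c (a ∷ w) k) (cong (k [] (c ∷ a ∷ w) +_) (cuts-∷ a w (λ p → k (c ∷ p)))))
         (trans (insert-cong c (λ w → cuts-∷ a w k) w) (insert-+ c (λ v → k [] (a ∷ v)) (λ w → ∑ (cuts w) (λ (p , q) → k (a ∷ p) q)) w)) ⟩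
  (x + (y + z)) + (t + insert c (λ w → ∑ (cuts w) (λ (p , q) → k (a ∷ p) q)) w)
    ≡⟨ cong (λ i → (x + (y + z)) + (t + i))
         (trans (insert-cuts c w (λ p → k (a ∷ p))) (∑-+ (cuts w) _ _)) ⟩
  (x + (y + z)) + (t + (i + j))
    ≡⟨ solve 6 (λ x y z t i j → (x :+ (y :+ z)) :+ (t :+ (i :+ j)) :=
         ((y :+ con 0ℚ) :+ (x :+ t)) :+ ((z :+ i) :+ j)) refl x y z t i j ⟩
  ((y + 0ℚ) + (x + t)) + ((z + i) + j)
    ≡⟨ cong₂ _+_ (cong ((y + 0ℚ) +_) (insert-∷ c (k []) a w))
         (cong (_+ j) (∑-+ (cuts w) _ _)) ⟨
  ((y + 0ℚ) + insert c (k []) (a ∷ w))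
    + (∑ (cuts w) (λ (p , q) → k (c ∷ a ∷ p) q + insert c (λ p → k (a ∷ p) q) p) + j)
    ≡⟨ cong (((y + 0ℚ) + insert c (k []) (a ∷ w)) +_)
         (trans (∑-cong (cuts w) (λ (p , q) → cong (_+ insert c (k (a ∷ p)) q) (insert-∷ c (λ p → k p q) a p)))
                (∑-+ (cuts w) _ _)) ⟨
  ((y + 0ℚ) + insert c (k []) (a ∷ w))
    + ∑ (cuts w) (λ (p , q) → insert c (λ p → k p q) (a ∷ p) + insert c (k (a ∷ p)) q)
    ≡⟨ cuts-∷ a w (λ p q → insert c (λ p → k p q) p + insert c (k p) q) ⟨
  ∑ (cuts (a ∷ w)) (λ (p , q) → insert c (λ p → k p q) p + insert c (k p) q) ∎
  where
  K : List _ → ℚ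
  K w = ∑ (cuts w) (λ (p , q) → k p q)
  x = k [] (c ∷ a ∷ w)
  y = k (c ∷ []) (a ∷ w)
  z = ∑ (cuts w) (λ (p , q) → k (c ∷ a ∷ p) q)
  t = insert c (λ v → k [] (a ∷ v)) w
  i = ∑ (cuts w) (λ (p , q) → insert c (λ p → k (a ∷ p) q) p)
  j = ∑ (cuts w) (λ (p , q) → insert c (k (a ∷ p)) q)

-- The marked letter of the enlarged word is either `c`, whose surroundings form a cut of `w`, or an
-- old letter with `c` somewhere to its left or right.
insert-places : ∀ (c : X) w (k : List X → X → List X → ℚ) →
  insert c (λ w → ∑ (places w) (λ (p , b , q) → k p b q)) w
    ≡ ∑ (cuts w) (λ (p , q) → k p c q)
      + ∑ (places w) (λ (p , b , q) → insert c (λ p → k p b q) p + insert c (k p b) q)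
insert-places c [] k = solve 1 (λ x → (x :+ con 0ℚ) :+ con 0ℚ := (x :+ con 0ℚ) :+ con 0ℚ) refl (k [] c [])
insert-places c (a ∷ w) k = begin
  insert c K (a ∷ w)
    ≡⟨ insert-∷ c K a w ⟩
  K (c ∷ a ∷ w) + insert c (λ w → K (a ∷ w)) w
    ≡⟨ cong₂ _+_
         (trans (places-∷ c (a ∷ w) k) (cong (k [] c (a ∷ w) +_) (places-∷ a w (λ p → k (c ∷ p)))))
         (trans (insert-cong c (λ w → places-∷ a w k) w) (insert-+ c (k [] a) (λ w → ∑ (places w) (λ (p , b , q) → k (a ∷ p) b q)) w)) ⟩
  (x + (y + z)) + (t + insert c (λ w → ∑ (places w) (λ (p , b , q) → k (a ∷ p) b q)) w)
    ≡⟨ cong (λ i → (x + (y + z)) + (t + i))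
         (trans (insert-places c w (λ p → k (a ∷ p))) (cong (u +_) (∑-+ (places w) _ _))) ⟩
  (x + (y + z)) + (t + (u + (i + j)))
    ≡⟨ solve 7 (λ x y z t u i j → (x :+ (y :+ z)) :+ (t :+ (u :+ (i :+ j))) :=
         (x :+ u) :+ (((y :+ con 0ℚ) :+ t) :+ ((z :+ i) :+ j))) refl x y z t u i j ⟩
  (x + u) + (((y + 0ℚ) + t) + ((z + i) + j))
    ≡⟨ cong₂ (λ x′ i′ → x′ + (((y + 0ℚ) + t) + (i′ + j)))
         (cuts-∷ a w (λ p → k p c)) (∑-+ (places w) _ _) ⟨
  cs + (((y + 0ℚ) + t)
    + (∑ (places w) (λ (p , b , q) → k (c ∷ a ∷ p) b q + insert c (λ p → k (a ∷ p) b q) p) + j))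
    ≡⟨ cong (λ z → cs + (((y + 0ℚ) + t) + z))
         (trans (∑-cong (places w) (λ (p , b , q) → cong (_+ insert c (k (a ∷ p) b) q) (insert-∷ c (λ p → k p b q) a p)))
                (∑-+ (places w) _ _)) ⟨
  cs + (((y + 0ℚ) + t)
    + ∑ (places w) (λ (p , b , q) → insert c (λ p → k p b q) (a ∷ p) + insert c (k (a ∷ p) b) q))
    ≡⟨ cong (cs +_) (places-∷ a w (λ p b q → insert c (λ p → k p b q) p + insert c (k p b) q)) ⟨
  cs + ∑ (places (a ∷ w)) (λ (p , b , q) → insert c (λ p → k p b q) p + insert c (k p b) q) ∎
  where
  K : List _ → ℚ
  K w = ∑ (places w) (λ (p , b , q) → k p b q)
  cs = ∑ (cuts (a ∷ w)) (λ (p , q) → k p c q)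
  x = k [] c (a ∷ w)
  y = k (c ∷ []) a w
  z = ∑ (places w) (λ (p , b , q) → k (c ∷ a ∷ p) b q)
  t = insert c (k [] a) w
  u = ∑ (cuts w) (λ (p , q) → k (a ∷ p) c q)
  i = ∑ (places w) (λ (p , b , q) → insert c (λ p → k (a ∷ p) b q) p)
  j = ∑ (places w) (λ (p , b , q) → insert c (k (a ∷ p) b) q)

-- Entries are distinguished by position: equal letters yield repeated words, as a sum over the
-- symmetric group requires.
perms : List X → List (List X)
perms []      = [] ∷ []
perms (x ∷ S) = concatMap (λ w → map (λ (p , q) → p ++ x ∷ q) (cuts w)) (perms S)

∑-perms-∷ : ∀ (x : X) S g → ∑ (perms (x ∷ S)) g ≡ ∑ (perms S) (insert x g)
∑-perms-∷ x S g =
  trans (∑-concatMap _ (perms S) g) (∑-cong (perms S) (λ w → ∑-map _ (cuts w) g))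

pick : List X → List (X × List X)
pick []      = []
pick (x ∷ S) = (x , S) ∷ map (map₂ (x ∷_)) (pick S)

pick-∷ : ∀ (x : X) S (k : X → List X → ℚ) →
  ∑ (pick (x ∷ S)) (λ (y , T) → k y T) ≡ k x S + ∑ (pick S) (λ (y , T) → k y (x ∷ T))
pick-∷ x S k = cong (k x S +_) (∑-map (map₂ (x ∷_)) (pick S) _)

pick-length : ∀ (S : List X) → All (λ (y , T) → suc (length T) ≡ length S) (pick S)
pick-length []      = []
pick-length (x ∷ S) = refl ∷ All.map⁺ (All.map (cong suc) (pick-length S))

-- Removing a letter from an arbitrary permutation of S is the same as choosing
-- the letter first and cutting an arbitrary permutation of the others.
perms-places : ∀ (S : List X) (k : List X → X → List X → ℚ) →
  ∑ (perms S) (λ w → ∑ (places w) (λ (p , b , q) → k p b q))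
    ≡ ∑ (pick S) (λ (y , T) → ∑ (perms T) (λ w → ∑ (cuts w) (λ (p , q) → k p y q)))
perms-places []      k = refl
perms-places (x ∷ S) k = begin
  ∑ (perms (x ∷ S)) (λ w → ∑ (places w) (λ (p , b , q) → k p b q))
    ≡⟨ ∑-perms-∷ x S _ ⟩
  ∑ (perms S) (insert x (λ w → ∑ (places w) (λ (p , b , q) → k p b q)))
    ≡⟨ trans (∑-cong (perms S) (λ w → insert-places x w k)) (∑-+ (perms S) _ _) ⟩
  ∑ (perms S) (λ w → ∑ (cuts w) (λ (p , q) → k p x q))
    + ∑ (perms S) (λ w → ∑ (places w) (λ (p , b , q) → k′ p b q))
    -- The induction hypothesis is used at `k′`, which inserts `x` on either side of the marked
    -- letter; `insert-cuts` then reads this as inserting `x` before cutting.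
    ≡⟨ cong (∑ (perms S) (λ w → ∑ (cuts w) (λ (p , q) → k p x q)) +_) (trans (perms-places S k′)
         (∑-cong (pick S) (λ (y , T) → sym (trans (∑-perms-∷ x T _)
           (∑-cong (perms T) (λ w → insert-cuts x w (λ p → k p y))))))) ⟩
  ∑ (perms S) (λ w → ∑ (cuts w) (λ (p , q) → k p x q))
    + ∑ (pick S) (λ (y , T) → ∑ (perms (x ∷ T)) (λ w → ∑ (cuts w) (λ (p , q) → k p y q)))
    ≡⟨ pick-∷ x S (λ y T → ∑ (perms T) (λ w → ∑ (cuts w) (λ (p , q) → k p y q))) ⟨
  ∑ (pick (x ∷ S)) (λ (y , T) → ∑ (perms T) (λ w → ∑ (cuts w) (λ (p , q) → k p y q))) ∎
  where
  k′ : List _ → _ → List _ → ℚ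
  k′ p b q = insert x (λ p → k p b q) p + insert x (k p b) q

-- Numerals and powers in ℚ

toℚᵘ-ℕtoℚ : ∀ n → toℚᵘ (ℕtoℚ n) ℚᵘ.≃ mkℚᵘ (ℤ.+ n) 0
toℚᵘ-ℕtoℚ n = toℚᵘ-fromℚᵘ (mkℚᵘ (ℤ.+ n) 0)

-- `ℕtoℚ` reduces a fraction by a gcd, which is stuck on a variable; in unnormalised rationals only
-- an identity of integers remains.
ℕtoℚ-suc : ∀ n → ℕtoℚ (suc n) ≡ 1ℚ + ℕtoℚ n
ℕtoℚ-suc n = toℚᵘ-injective (ℚᵘ.≃-trans (toℚᵘ-ℕtoℚ (suc n)) (ℚᵘ.≃-sym
  (ℚᵘ.≃-trans (toℚᵘ-homo-+ 1ℚ (ℕtoℚ n))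
  (ℚᵘ.≃-trans (ℚᵘ.+-congʳ (toℚᵘ 1ℚ) (toℚᵘ-ℕtoℚ n))
    (*≡* (cong (λ z → (ℤ.+ 1 ℤ.+ z) ℤ.* ℤ.+ 1) (ℤ.*-identityʳ (ℤ.+ n))))))))

ℕtoℚ-* : ∀ m n → ℕtoℚ (m ℕ.* n) ≡ ℕtoℚ m * ℕtoℚ n
ℕtoℚ-* m n = toℚᵘ-injective (ℚᵘ.≃-trans (toℚᵘ-ℕtoℚ (m ℕ.* n)) (ℚᵘ.≃-sym
  (ℚᵘ.≃-trans (toℚᵘ-homo-* (ℕtoℚ m) (ℕtoℚ n))
  (ℚᵘ.≃-trans (ℚᵘ.*-cong (toℚᵘ-ℕtoℚ m) (toℚᵘ-ℕtoℚ n))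
    (*≡* (cong (ℤ._* ℤ.+ 1) (sym (ℤ.pos-* m n))))))))

^ℚ-distrib-* : ∀ a b n → (a * b) ^ℚ n ≡ (a ^ℚ n) * (b ^ℚ n)
^ℚ-distrib-* a b zero    = refl
^ℚ-distrib-* a b (suc n) = trans (cong (a * b *_) (^ℚ-distrib-* a b n))
  (solve 4 (λ a b x y → (a :* b) :* (x :* y) := (a :* x) :* (b :* y)) refl a b (a ^ℚ n) (b ^ℚ n))

^ℚ-distribˡ-+-* : ∀ a m n → a ^ℚ (m ℕ.+ n) ≡ (a ^ℚ m) * (a ^ℚ n)
^ℚ-distribˡ-+-* a zero    n = sym (*-identityˡ (a ^ℚ n))
^ℚ-distribˡ-+-* a (suc m) n =
  trans (cong (a *_) (^ℚ-distribˡ-+-* a m n)) (sym (*-assoc a (a ^ℚ m) (a ^ℚ n)))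

-- Sublists and their complements

splits : List X → List (List X × List X)
splits []      = ([] , []) ∷ []
splits (x ∷ S) = concatMap (λ (T , U) → (x ∷ T , U) ∷ (T , x ∷ U) ∷ []) (splits S)

splits-∷ : ∀ (x : X) S (k : List X → List X → ℚ) →
  ∑ (splits (x ∷ S)) (λ (T , U) → k T U)
    ≡ ∑ (splits S) (λ (T , U) → k (x ∷ T) U + k T (x ∷ U))
splits-∷ x S k = trans (∑-concatMap _ (splits S) _)
  (∑-cong (splits S) (λ (T , U) → cong (λ z → k (x ∷ T) U + z) (+-identityʳ (k T (x ∷ U)))))

splits-length : ∀ (S : List X) → All (λ (T , U) → length U ℕ.≤ length S) (splits S)
splits-length []      = z≤n ∷ []
splits-length (x ∷ S) = All.concat⁺ (All.map⁺ (All.map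
  (λ le → ℕ.≤-trans le (ℕ.n≤1+n (length S)) ∷ s≤s le ∷ []) (splits-length S)))

-- Either a sublist is chosen first and `y` inside it, or `y` first and the rest of the sublist
-- afterwards.
splits-pick : ∀ (S : List X) (k : X → List X → List X → ℚ) →
  ∑ (splits S) (λ (T , U) → ∑ (pick T) (λ (y , T′) → k y T′ U))
    ≡ ∑ (pick S) (λ (y , S′) → ∑ (splits S′) (λ (T , U) → k y T U))
splits-pick []      k = refl
splits-pick (x ∷ S) k = begin
  ∑ (splits (x ∷ S)) (λ (T , U) → ∑ (pick T) (λ (y , T′) → k y T′ U))
    ≡⟨ splits-∷ x S (λ T U → ∑ (pick T) (λ (y , T′) → k y T′ U)) ⟩
  ∑ (splits S) (λ (T , U) → ∑ (pick (x ∷ T)) (λ (y , T′) → k y T′ U)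
    + ∑ (pick T) (λ (y , T′) → k y T′ (x ∷ U)))
    ≡⟨ ∑-cong (splits S) (λ (T , U) → trans
         (cong (_+ ∑ (pick T) (λ (y , T′) → k y T′ (x ∷ U))) (pick-∷ x T (λ y T′ → k y T′ U)))
         (trans (+-assoc (k x T U) (∑ (pick T) (λ (y , T′) → k y (x ∷ T′) U)) (∑ (pick T) (λ (y , T′) → k y T′ (x ∷ U))))
           (cong (k x T U +_) (sym (∑-+ (pick T) _ _))))) ⟩
  ∑ (splits S) (λ (T , U) → k x T U + ∑ (pick T) (λ (y , T′) → k y (x ∷ T′) U + k y T′ (x ∷ U)))
    ≡⟨ trans (∑-+ (splits S) _ _) (cong (∑ (splits S) (λ (T , U) → k x T U) +_)
         (splits-pick S (λ y T U → k y (x ∷ T) U + k y T (x ∷ U)))) ⟩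
  ∑ (splits S) (λ (T , U) → k x T U)
    + ∑ (pick S) (λ (y , S′) → ∑ (splits S′) (λ (T , U) → k y (x ∷ T) U + k y T (x ∷ U)))
    ≡⟨ cong (∑ (splits S) (λ (T , U) → k x T U) +_) (∑-cong (pick S) (λ (y , S′) → splits-∷ x S′ (k y))) ⟨
  ∑ (splits S) (λ (T , U) → k x T U)
    + ∑ (pick S) (λ (y , S′) → ∑ (splits (x ∷ S′)) (λ (T , U) → k y T U))
    ≡⟨ pick-∷ x S (λ y S′ → ∑ (splits S′) (λ (T , U) → k y T U)) ⟨
  ∑ (pick (x ∷ S)) (λ (y , S′) → ∑ (splits S′) (λ (T , U) → k y T U)) ∎

-- The Kronecker factor for an empty list; it carries the inhomogeneous term of the recursion for
-- `fuseSum`.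
whenNil : List X → ℚ → ℚ
whenNil []      q = q
whenNil (_ ∷ _) q = 0ℚ

splits-nil : ∀ (S : List X) (k : List X → ℚ) →
  ∑ (splits S) (λ (T , U) → whenNil T (k U)) ≡ k S
splits-nil []      k = +-identityʳ (k [])
splits-nil (x ∷ S) k = begin
  ∑ (splits (x ∷ S)) (λ (T , U) → whenNil T (k U))
    ≡⟨ splits-∷ x S (λ T U → whenNil T (k U)) ⟩
  ∑ (splits S) (λ (T , U) → 0ℚ + whenNil T (k (x ∷ U)))
    ≡⟨ ∑-cong (splits S) (λ (T , U) → +-identityˡ (whenNil T (k (x ∷ U)))) ⟩
  ∑ (splits S) (λ (T , U) → whenNil T (k (x ∷ U)))
    ≡⟨ splits-nil S (λ U → k (x ∷ U)) ⟩
  k (x ∷ S) ∎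

-- Set partitions with a marked block

-- The marked block may be empty.
marked : (List X → List (List⁺ X) → ℚ) → List (List⁺ X) → ℚ
marked h P = h [] P + ∑ (pick P) (λ (B , P′) → h (List⁺.toList B) P′)

inserts-∷ : ∀ (x : X) B P (f : List (List⁺ X) → ℚ) →
  ∑ (inserts x (B ∷ P)) f ≡ f ((x ∷ List⁺.toList B) ∷ P) + ∑ (inserts x P) (λ P′ → f (B ∷ P′))
inserts-∷ x B P f = cong (f ((x ∷ List⁺.toList B) ∷ P) +_) (∑-map (B ∷_) (inserts x P) f)

-- The block picked after inserting `y` is either the one that received `y`, or another one, and
-- then `y` went into one of the remaining blocks.
inserts-pick : ∀ (y : X) P (h : List X → List (List⁺ X) → ℚ) →
  ∑ (inserts y P) (λ P₁ → ∑ (pick P₁) (λ (B , P′) → h (List⁺.toList B) P′))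
    ≡ ∑ (pick P) (λ (B , P′) → h (y ∷ List⁺.toList B) P′ + ∑ (inserts y P′) (h (List⁺.toList B)))
inserts-pick y []      h = refl
inserts-pick y (B ∷ P) h = begin
  ∑ (inserts y (B ∷ P)) picks
    ≡⟨ inserts-∷ y B P picks ⟩
  picks ((y ∷ List⁺.toList B) ∷ P) + ∑ (inserts y P) (λ P′ → picks (B ∷ P′))
    ≡⟨ cong₂ _+_ (pick-∷ (y ∷ List⁺.toList B) P (λ B → h (List⁺.toList B)))
         (trans (∑-cong (inserts y P) (λ P′ → pick-∷ B P′ (λ B → h (List⁺.toList B))))
           (trans (∑-+ (inserts y P) _ _) (cong (b +_) (inserts-pick y P (λ T P′ → h T (B ∷ P′)))))) ⟩
  (a + c) + (b + ∑ (pick P) (λ (B′ , P′) → h (y ∷ List⁺.toList B′) (B ∷ P′) + ∑ (inserts y P′) (λ P″ → h (List⁺.toList B′) (B ∷ P″))))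
    ≡⟨ cong (λ z → (a + c) + (b + z)) (∑-+ (pick P) _ _) ⟩
  (a + c) + (b + (d + e))
    ≡⟨ solve 5 (λ a b c d e → (a :+ c) :+ (b :+ (d :+ e)) := (a :+ b) :+ (d :+ (c :+ e))) refl a b c d e ⟩
  (a + b) + (d + (c + e))
    ≡⟨ cong ((a + b) +_) (trans (∑-+ (pick P) _ _) (cong (d +_) (∑-+ (pick P) _ _))) ⟨
  (a + b) + ∑ (pick P) (λ (B′ , P′) → h (y ∷ List⁺.toList B′) (B ∷ P′)
    + (h (List⁺.toList B′) ((y ∷ List⁺.toList B) ∷ P′) + ∑ (inserts y P′) (λ P″ → h (List⁺.toList B′) (B ∷ P″))))
    ≡⟨ cong ((a + b) +_) (∑-cong (pick P) (λ (B′ , P′) →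
         cong (h (y ∷ List⁺.toList B′) (B ∷ P′) +_) (inserts-∷ y B P′ (h (List⁺.toList B′))))) ⟨
  (a + b) + ∑ (pick P) (λ (B′ , P′) → h (y ∷ List⁺.toList B′) (B ∷ P′)
    + ∑ (inserts y (B ∷ P′)) (h (List⁺.toList B′)))
    ≡⟨ pick-∷ B P (λ B P′ → h (y ∷ List⁺.toList B) P′ + ∑ (inserts y P′) (h (List⁺.toList B))) ⟨
  ∑ (pick (B ∷ P)) (λ (B , P′) → h (y ∷ List⁺.toList B) P′ + ∑ (inserts y P′) (h (List⁺.toList B))) ∎
  where
  picks : List (List⁺ _) → ℚ
  picks P₁ = ∑ (pick P₁) (λ (B , P′) → h (List⁺.toList B) P′)
  a = h (y ∷ List⁺.toList B) P
  b = ∑ (inserts y P) (h (List⁺.toList B))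
  c = ∑ (pick P) (λ (B′ , P′) → h (List⁺.toList B′) ((y ∷ List⁺.toList B) ∷ P′))
  d = ∑ (pick P) (λ (B′ , P′) → h (y ∷ List⁺.toList B′) (B ∷ P′))
  e = ∑ (pick P) (λ (B′ , P′) → ∑ (inserts y P′) (λ P″ → h (List⁺.toList B′) (B ∷ P″)))

partitions-∷ : ∀ (x : X) S (f : List (List⁺ X) → ℚ) →
  ∑ (partitions (x ∷ S)) f ≡ ∑ (partitions S) (λ P → f ((x ∷ []) ∷ P) + ∑ (inserts x P) f)
partitions-∷ x S f = ∑-concatMap _ (partitions S) f

-- A possibly empty marked block is an arbitrary sublist `T`, and the other blocks partition its
-- complement `U`. Adding a new element to the marked block gives all partitions of the enlarged
-- list, so this isolates the block of that element.
partitions-marked : ∀ (S : List X) (h : List X → List (List⁺ X) → ℚ) →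
  ∑ (partitions S) (marked h) ≡ ∑ (splits S) (λ (T , U) → ∑ (partitions U) (h T))
partitions-marked []      h =
  solve 1 (λ x → (x :+ con 0ℚ) :+ con 0ℚ := (x :+ con 0ℚ) :+ con 0ℚ) refl (h [] [])
partitions-marked (y ∷ S) h = begin
  ∑ (partitions (y ∷ S)) (marked h)
    ≡⟨ partitions-∷ y S (marked h) ⟩
  ∑ (partitions S) (λ P → marked h ((y ∷ []) ∷ P) + ∑ (inserts y P) (marked h))
    ≡⟨ ∑-cong (partitions S) point ⟩
  ∑ (partitions S) (marked h′)
    ≡⟨ partitions-marked S h′ ⟩
  ∑ (splits S) (λ (T , U) → ∑ (partitions U) (h′ T))
    ≡⟨ ∑-cong (splits S) (λ (T , U) → trans (∑-+ (partitions U) _ _)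
         (cong (∑ (partitions U) (h (y ∷ T)) +_) (sym (partitions-∷ y U (h T))))) ⟩
  ∑ (splits S) (λ (T , U) → ∑ (partitions U) (h (y ∷ T)) + ∑ (partitions (y ∷ U)) (h T))
    ≡⟨ splits-∷ y S (λ T U → ∑ (partitions U) (h T)) ⟨
  ∑ (splits (y ∷ S)) (λ (T , U) → ∑ (partitions U) (h T)) ∎
  where
  -- The three positions of `y` relative to the marked block: inside it, alone in a block, or in
  -- another existing block.
  h′ : List _ → List (List⁺ _) → ℚ
  h′ T Q = h (y ∷ T) Q + (h T ((y ∷ []) ∷ Q) + ∑ (inserts y Q) (h T))

  point : ∀ P → marked h ((y ∷ []) ∷ P) + ∑ (inserts y P) (marked h) ≡ marked h′ P
  point P = begin
    marked h ((y ∷ []) ∷ P) + ∑ (inserts y P) (marked h)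
      ≡⟨ cong₂ (λ u v → (a + u) + v) (pick-∷ (y ∷ []) P (λ B → h (List⁺.toList B)))
           (trans (∑-+ (inserts y P) _ _) (cong (d +_)
             (trans (inserts-pick y P h) (∑-+ (pick P) _ _)))) ⟩
    (a + (b + c)) + (d + (e + f))
      ≡⟨ solve 6 (λ a b c d e f → (a :+ (b :+ c)) :+ (d :+ (e :+ f)) :=
           (b :+ (a :+ d)) :+ (e :+ (c :+ f))) refl a b c d e f ⟩
    (b + (a + d)) + (e + (c + f))
      ≡⟨ cong ((b + (a + d)) +_) (trans (∑-+ (pick P) _ _) (cong (e +_) (∑-+ (pick P) _ _))) ⟨
    marked h′ P ∎
    where
    a = h [] ((y ∷ []) ∷ P)
    b = h (y ∷ []) P
    c = ∑ (pick P) (λ (B , P′) → h (List⁺.toList B) ((y ∷ []) ∷ P′))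
    d = ∑ (inserts y P) (h [])
    e = ∑ (pick P) (λ (B , P′) → h (y ∷ List⁺.toList B) P′)
    f = ∑ (pick P) (λ (B , P′) → ∑ (inserts y P′) (h (List⁺.toList B)))

-- Passing from indices to letters

insert-map : ∀ (f : X → Y) x (g : List Y → ℚ) w →
  insert x (λ v → g (map f v)) w ≡ insert (f x) g (map f w)
insert-map f x g []      = refl
insert-map f x g (a ∷ w) = begin
  insert x (λ v → g (map f v)) (a ∷ w)
    ≡⟨ insert-∷ x (λ v → g (map f v)) a w ⟩
  g (f x ∷ f a ∷ map f w) + insert x (λ v → g (f a ∷ map f v)) w
    ≡⟨ cong (g (f x ∷ f a ∷ map f w) +_) (insert-map f x (λ v → g (f a ∷ v)) w) ⟩
  g (f x ∷ f a ∷ map f w) + insert (f x) (λ v → g (f a ∷ v)) (map f w)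
    ≡⟨ insert-∷ (f x) g (f a) (map f w) ⟨
  insert (f x) g (map f (a ∷ w)) ∎

perms-map : ∀ (f : X → Y) S (g : List Y → ℚ) →
  ∑ (perms S) (λ w → g (map f w)) ≡ ∑ (perms (map f S)) g
perms-map f []      g = refl
perms-map f (x ∷ S) g = begin
  ∑ (perms (x ∷ S)) (λ w → g (map f w))            ≡⟨ ∑-perms-∷ x S _ ⟩
  ∑ (perms S) (insert x (λ w → g (map f w)))       ≡⟨ ∑-cong (perms S) (insert-map f x g) ⟩
  ∑ (perms S) (λ w → insert (f x) g (map f w))     ≡⟨ perms-map f S (insert (f x) g) ⟩
  ∑ (perms (map f S)) (insert (f x) g)             ≡⟨ ∑-perms-∷ (f x) (map f S) g ⟨
  ∑ (perms (map f (x ∷ S))) g                      ∎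

-- `perms` grows by inserting the first element anywhere, whereas tuples are enumerated from the
-- left; this is the expansion by the first letter of the resulting word.
perms-pick : ∀ (x : X) S g → ∑ (perms (x ∷ S)) g ≡
  ∑ (pick (x ∷ S)) (λ (y , T) → ∑ (perms T) (λ w → g (y ∷ w)))
perms-pick x []         g = sym (+-identityʳ _)
perms-pick x S@(y ∷ S′) g = begin
  ∑ (perms (x ∷ S)) g
    ≡⟨ ∑-perms-∷ x S g ⟩
  ∑ (perms S) (insert x g)
    ≡⟨ perms-pick y S′ (insert x g) ⟩
  ∑ (pick S) (λ (z , T) → ∑ (perms T) (λ w → insert x g (z ∷ w)))
    ≡⟨ ∑-cong (pick S) (λ (z , T) → trans (∑-cong (perms T) (λ w → insert-∷ x g z w))
         (trans (∑-+ (perms T) _ _)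
           (cong (∑ (perms T) (λ w → g (x ∷ z ∷ w)) +_) (sym (∑-perms-∷ x T (λ w → g (z ∷ w))))))) ⟩
  ∑ (pick S) (λ (z , T) → ∑ (perms T) (λ w → g (x ∷ z ∷ w)) + ∑ (perms (x ∷ T)) (λ w → g (z ∷ w)))
    ≡⟨ ∑-+ (pick S) (λ (z , T) → ∑ (perms T) (λ w → g (x ∷ z ∷ w)))
                    (λ (z , T) → ∑ (perms (x ∷ T)) (λ w → g (z ∷ w))) ⟩
  ∑ (pick S) (λ (z , T) → ∑ (perms T) (λ w → g (x ∷ z ∷ w)))
    + ∑ (pick S) (λ (z , T) → ∑ (perms (x ∷ T)) (λ w → g (z ∷ w)))
    ≡⟨ cong (_+ ∑ (pick S) (λ (z , T) → ∑ (perms (x ∷ T)) (λ w → g (z ∷ w)))) (perms-pick y S′ (λ w → g (x ∷ w))) ⟨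
  ∑ (perms S) (λ w → g (x ∷ w)) + ∑ (pick S) (λ (z , T) → ∑ (perms (x ∷ T)) (λ w → g (z ∷ w)))
    ≡⟨ pick-∷ x S (λ z T → ∑ (perms T) (λ w → g (z ∷ w))) ⟨
  ∑ (pick (x ∷ S)) (λ (z , T) → ∑ (perms T) (λ w → g (z ∷ w))) ∎

inserts-map : ∀ (f : X → Y) x P (h : List (List⁺ Y) → ℚ) →
  ∑ (inserts x P) (λ P′ → h (map (List⁺.map f) P′)) ≡ ∑ (inserts (f x) (map (List⁺.map f) P)) h
inserts-map f x []      h = refl
inserts-map f x (B ∷ P) h = begin
  ∑ (inserts x (B ∷ P)) (λ P′ → h (map (List⁺.map f) P′))
    ≡⟨ inserts-∷ x B P (λ P′ → h (map (List⁺.map f) P′)) ⟩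
  y + ∑ (inserts x P) (λ P′ → h (List⁺.map f B ∷ map (List⁺.map f) P′))
    ≡⟨ cong (y +_) (inserts-map f x P (λ P′ → h (List⁺.map f B ∷ P′))) ⟩
  y + ∑ (inserts (f x) (map (List⁺.map f) P)) (λ P′ → h (List⁺.map f B ∷ P′))
    ≡⟨ inserts-∷ (f x) (List⁺.map f B) (map (List⁺.map f) P) h ⟨
  ∑ (inserts (f x) (map (List⁺.map f) (B ∷ P))) h ∎
  where y = h (map (List⁺.map f) ((x ∷ List⁺.toList B) ∷ P))

partitions-map : ∀ (f : X → Y) S (h : List (List⁺ Y) → ℚ) →
  ∑ (partitions S) (λ P → h (map (List⁺.map f) P)) ≡ ∑ (partitions (map f S)) h
partitions-map f []      h = refl
partitions-map f (x ∷ S) h = begin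
  ∑ (partitions (x ∷ S)) (λ P → h (map (List⁺.map f) P))
    ≡⟨ partitions-∷ x S (λ P → h (map (List⁺.map f) P)) ⟩
  ∑ (partitions S) (λ P → h (map (List⁺.map f) ((x ∷ []) ∷ P)) + ∑ (inserts x P) (λ P → h (map (List⁺.map f) P)))
    ≡⟨ ∑-cong (partitions S) (λ P → cong (h (map (List⁺.map f) ((x ∷ []) ∷ P)) +_) (inserts-map f x P h)) ⟩
  ∑ (partitions S) (λ P → h′ (map (List⁺.map f) P))
    ≡⟨ partitions-map f S h′ ⟩
  ∑ (partitions (map f S)) h′
    ≡⟨ partitions-∷ (f x) (map f S) h ⟨
  ∑ (partitions (map f (x ∷ S))) h ∎
  where
  h′ : List (List⁺ _) → ℚ
  h′ P = h ((f x ∷ []) ∷ P) + ∑ (inserts (f x) P) h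

-- The number of elements of a partition

size : List (List⁺ X) → ℕ
size = foldr (λ B s → List⁺.length B ℕ.+ s) 0

-- Keeps the truncated subtraction in the exponent of the sign exact when a block is split off.
length≤size : ∀ (P : List (List⁺ X)) → length P ℕ.≤ size P
length≤size []      = z≤n
length≤size (B ∷ P) = s≤s (ℕ.m≤n⇒m≤o+n (length (List⁺.tail B)) (length≤size P))

inserts-size : ∀ (x : X) P → All (λ P′ → size P′ ≡ suc (size P)) (inserts x P)
inserts-size x []      = []
inserts-size x (B ∷ P) = refl ∷ All.map⁺ (All.map
  (λ e → trans (cong (List⁺.length B ℕ.+_) e) (ℕ.+-suc (List⁺.length B) (size P))) (inserts-size x P))

partitions-size : ∀ (S : List X) → All (λ P → size P ≡ length S) (partitions S)
partitions-size []      = refl ∷ []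
partitions-size (x ∷ S) = All.concat⁺ (All.map⁺ (All.map
  (λ {P} e → cong suc e ∷ All.map (λ e′ → trans e′ (cong suc e)) (inserts-size x P))
  (partitions-size S)))

-- The symmetric group

indicator : ∀ {p} {P : Set p} → Dec P → ℚ
indicator (yes _) = 1ℚ
indicator (no  _) = 0ℚ

∑-filter : ∀ {p} {P : X → Set p} (P? : ∀ x → Dec (P x)) L f →
  ∑ (filter P? L) f ≡ ∑ L (λ x → indicator (P? x) * f x)
∑-filter P? []      f = refl
∑-filter P? (x ∷ L) f with P? x
... | yes _ = cong₂ _+_ (sym (*-identityˡ (f x))) (∑-filter P? L f)
... | no  _ = trans (∑-filter P? L f)
  (sym (trans (cong (_+ ∑ L (λ x → indicator (P? x) * f x)) (*-zeroˡ (f x))) (+-identityˡ _)))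

pick-∈ : ∀ (S : List X) → All (λ (y , _) → y ∈ S) (pick S)
pick-∈ []      = []
pick-∈ (x ∷ S) = here refl ∷ All.map⁺ (All.map there (pick-∈ S))

module _ {X : Set} (_≟_ : DecidableEquality X) where

  open import Data.List.Membership.DecPropositional _≟_ using (_∈?_)

  δ-≢ : ∀ {x y} → y ≢ x → δ _≟_ x y ≡ 0ℚ
  δ-≢ {x} {y} y≢x with y ≟ x
  ... | yes e = contradiction e y≢x
  ... | no  _ = refl

  ∑-δ-0 : ∀ {Y : Set} i (L : List Y) (j : Y → X) (h : Y → ℚ) →
    All (λ y → j y ≢ i) L → ∑ L (λ y → δ _≟_ i (j y) * h y) ≡ 0ℚ
  ∑-δ-0 i L j h ≢i = trans
    (∑-cong-All L (All.map (λ {y} e → trans (cong (_* h y) (δ-≢ e)) (*-zeroˡ (h y))) ≢i)) (∑-0 L)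

  ∑-δ : ∀ {L} → Unique L → ∀ {i} → i ∈ L → ∀ (h : X → ℚ) → ∑ L (λ j → δ _≟_ i j * h j) ≡ h i
  ∑-δ {y ∷ L} (y∉ ∷ uL) (here refl) h = begin
    δ _≟_ y y * h y + ∑ L (λ j → δ _≟_ y j * h j)
      ≡⟨ cong₂ (λ d z → d * h y + z) (δ-≡ _≟_ y) (∑-δ-0 y L (λ j → j) h (All.map ≢-sym y∉)) ⟩
    1ℚ * h y + 0ℚ
      ≡⟨ trans (+-identityʳ _) (*-identityˡ (h y)) ⟩
    h y ∎
  ∑-δ {y ∷ L} (y∉ ∷ uL) {i} (there m) h = begin
    δ _≟_ i y * h y + ∑ L (λ j → δ _≟_ i j * h j)
      ≡⟨ cong₂ (λ d z → d * h y + z) (δ-≢ (All.lookup y∉ m)) (∑-δ uL m h) ⟩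
    0ℚ * h y + h i
      ≡⟨ trans (cong (_+ h i) (*-zeroˡ (h y))) (+-identityˡ (h i)) ⟩
    h i ∎

  _∖_ : List X → X → List X
  R ∖ i = filter (λ j → ¬? (j ≟ i)) R

  -- Without repetitions in `R`, exactly one pick takes out `i`.
  pick-δ : ∀ {R} → Unique R → ∀ {i} → i ∈ R → ∀ (h : List X → ℚ) →
    ∑ (pick R) (λ (j , T) → δ _≟_ i j * h T) ≡ h (R ∖ i)
  pick-δ {y ∷ R} (y∉ ∷ uR) (here refl) h = begin
    ∑ (pick (y ∷ R)) (λ (j , T) → δ _≟_ y j * h T)
      ≡⟨ pick-∷ y R (λ j T → δ _≟_ y j * h T) ⟩
    δ _≟_ y y * h R + ∑ (pick R) (λ (j , T) → δ _≟_ y j * h (y ∷ T))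
      ≡⟨ cong₂ (λ d z → d * h R + z) (δ-≡ _≟_ y)
           (∑-δ-0 y (pick R) proj₁ (λ (_ , T) → h (y ∷ T))
             (All.map (λ m → ≢-sym (All.lookup y∉ m)) (pick-∈ R))) ⟩
    1ℚ * h R + 0ℚ
      ≡⟨ trans (+-identityʳ _) (*-identityˡ (h R)) ⟩
    h R
      ≡⟨ cong h (trans (filter-reject (λ j → ¬? (j ≟ y)) (λ ¬e → ¬e refl))
           (filter-all (λ j → ¬? (j ≟ y)) (All.map ≢-sym y∉))) ⟨
    h ((y ∷ R) ∖ y) ∎
  pick-δ {y ∷ R} (y∉ ∷ uR) {i} (there m) h = begin
    ∑ (pick (y ∷ R)) (λ (j , T) → δ _≟_ i j * h T)
      ≡⟨ pick-∷ y R (λ j T → δ _≟_ i j * h T) ⟩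
    δ _≟_ i y * h R + ∑ (pick R) (λ (j , T) → δ _≟_ i j * h (y ∷ T))
      ≡⟨ cong₂ (λ d z → d * h R + z) (δ-≢ y≢i) (pick-δ uR m (λ T → h (y ∷ T))) ⟩
    0ℚ * h R + h (y ∷ (R ∖ i))
      ≡⟨ trans (cong (_+ h (y ∷ (R ∖ i))) (*-zeroˡ (h R))) (+-identityˡ (h (y ∷ (R ∖ i)))) ⟩
    h (y ∷ (R ∖ i))
      ≡⟨ cong h (filter-accept (λ j → ¬? (j ≟ i)) y≢i) ⟨
    h ((y ∷ R) ∖ i) ∎
    where
    y≢i : y ≢ i
    y≢i = All.lookup y∉ m

  -- The number of ways to draw the entries of the second list in order, without replacement, from
  -- `R`. If `R` has no repetitions, this is the indicator of a list of distinct members of `R`, but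
  -- with a recursion that matches `pick`.
  draws : List X → List X → ℚ
  draws R []      = 1ℚ
  draws R (i ∷ v) = ∑ (pick R) (λ (j , T) → δ _≟_ i j * draws T v)

  draws-∈ : ∀ {R} → Unique R → ∀ {i} → i ∈ R → ∀ v → draws R (i ∷ v) ≡ draws (R ∖ i) v
  draws-∈ uR m v = pick-δ uR m (λ T → draws T v)

  draws-∉ : ∀ {R i} → i ∉ R → ∀ v → draws R (i ∷ v) ≡ 0ℚ
  draws-∉ {R} {i} i∉R v = ∑-δ-0 i (pick R) proj₁ (λ (_ , T) → draws T v)
    (All.map (λ { m refl → i∉R m }) (pick-∈ R))

  ∖-unique : ∀ {R} i → Unique R → Unique (R ∖ i)
  ∖-unique i = Unique.filter⁺ (λ j → ¬? (j ≟ i))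

  draws-unique : ∀ {R} → Unique R → ∀ {v} → Unique v → All (_∈ R) v → draws R v ≡ 1ℚ
  draws-unique uR []          []        = refl
  draws-unique uR {i ∷ v} (i∉ ∷ uv) (m ∷ ms) = trans (draws-∈ uR m v)
    (draws-unique (∖-unique i uR) uv
      (All.zipWith (λ (i≢j , m) → ∈-filter⁺ (λ j → ¬? (j ≟ i)) m (≢-sym i≢j)) (i∉ , ms)))

  draws-missing : ∀ {R} → Unique R → ∀ {z v} → z ∈ v → z ∉ R → draws R v ≡ 0ℚ
  draws-missing {R} uR {v = i ∷ v} m z∉R with i ∈? R
  ... | no  i∉R = draws-∉ i∉R v
  draws-missing uR {v = i ∷ v} (here refl) z∉R | yes i∈R = contradiction i∈R z∉R
  draws-missing uR {v = i ∷ v} (there m)   z∉R | yes i∈R = trans (draws-∈ uR i∈R v)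
    (draws-missing (∖-unique i uR) m (λ m′ → z∉R (proj₁ (∈-filter⁻ (λ j → ¬? (j ≟ i)) m′))))

  -- Once the first copy of a repeated entry has been drawn, the second is missing from what
  -- remains.
  draws-repeated : ∀ {R} → Unique R → ∀ v → ¬ Unique v → draws R v ≡ 0ℚ
  draws-repeated uR []          ¬uv = contradiction [] ¬uv
  draws-repeated {R} uR (i ∷ v) ¬uv with i ∈? R
  ... | no i∉R = draws-∉ i∉R v
  ... | yes i∈R with i ∈? v
  ...   | yes i∈v = trans (draws-∈ uR i∈R v) (draws-missing (∖-unique i uR) i∈v
                      (λ m → proj₂ (∈-filter⁻ (λ j → ¬? (j ≟ i)) {xs = R} m) refl))
  ...   | no  i∉v = trans (draws-∈ uR i∈R v) (draws-repeated (∖-unique i uR) v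
                      (λ uv → ¬uv (All.¬Any⇒All¬ v i∉v ∷ uv)))

-- The first coordinate runs over all of `Fin n`, and the delta in `draws` reduces it to the element
-- drawn.
draws-pick : ∀ n k R (f : List (Fin n) → ℚ) →
  ∑ (allVecs n (suc k)) (λ v → draws Fin._≟_ R (toList v) * f (toList v))
    ≡ ∑ (pick R) (λ (j , T) → ∑ (allVecs n k) (λ v → draws Fin._≟_ T (toList v) * f (j ∷ toList v)))
draws-pick n k R f = begin
  ∑ (allVecs n (suc k)) (λ v → draws Fin._≟_ R (toList v) * f (toList v))
    ≡⟨ trans (∑-concatMap _ (allFin n) _) (∑-cong (allFin n) (λ i → ∑-map (i ∷_) (allVecs n k) _)) ⟩
  ∑ (allFin n) (λ i → ∑ (allVecs n k) (λ v → draws Fin._≟_ R (i ∷ toList v) * f (i ∷ toList v)))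
    ≡⟨ ∑-cong (allFin n) (λ i → trans (∑-cong (allVecs n k) (λ v → distrib i (toList v)))
         (∑-swap (allVecs n k) (pick R) _)) ⟩
  ∑ (allFin n) (λ i → ∑ (pick R) (λ (j , T) → ∑ (allVecs n k) (λ v → δ Fin._≟_ j i * G T i v)))
    ≡⟨ trans (∑-swap (allFin n) (pick R) _) (∑-cong (pick R) (λ (j , T) → trans
         (∑-cong (allFin n) (λ i → ∑-* (allVecs n k) (δ Fin._≟_ j i) (G T i)))
         (∑-δ Fin._≟_ (Unique.allFin⁺ n) (∈-allFin j) (λ i → ∑ (allVecs n k) (G T i))))) ⟩
  ∑ (pick R) (λ (j , T) → ∑ (allVecs n k) (G T j)) ∎
  where
  G : List (Fin n) → Fin n → Vec (Fin n) k → ℚ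
  G T i v = draws Fin._≟_ T (toList v) * f (i ∷ toList v)

  δ-sym : ∀ (i j : Fin n) → δ Fin._≟_ i j ≡ δ Fin._≟_ j i
  δ-sym i j with i Fin.≟ j
  ... | yes refl = δ-≡ Fin._≟_ i
  ... | no i≢j   = δ-≢ Fin._≟_ (≢-sym i≢j)

  distrib : ∀ i w → draws Fin._≟_ R (i ∷ w) * f (i ∷ w) ≡
    ∑ (pick R) (λ (j , T) → δ Fin._≟_ j i * (draws Fin._≟_ T w * f (i ∷ w)))
  distrib i w = trans (*-comm (draws Fin._≟_ R (i ∷ w)) (f (i ∷ w)))
    (trans (sym (∑-* (pick R) (f (i ∷ w)) _)) (∑-cong (pick R) (λ (j , T) → trans
      (solve 3 (λ f d n → f :* (d :* n) := d :* (n :* f)) refl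
        (f (i ∷ w)) (δ Fin._≟_ i j) (draws Fin._≟_ T w))
      (cong (_* (draws Fin._≟_ T w * f (i ∷ w))) (δ-sym i j)))))

-- With as many coordinates as elements of `R`, the drawing exhausts `R` and so produces its
-- permutations.
allVecs-draws : ∀ n k R → length R ≡ k → ∀ (f : List (Fin n) → ℚ) →
  ∑ (allVecs n k) (λ v → draws Fin._≟_ R (toList v) * f (toList v)) ≡ ∑ (perms R) f
allVecs-draws n zero    []      e f = cong (_+ 0ℚ) (*-identityˡ (f []))
allVecs-draws n (suc k) (x ∷ S) e f = begin
  ∑ (allVecs n (suc k)) (λ v → draws Fin._≟_ (x ∷ S) (toList v) * f (toList v))
    ≡⟨ draws-pick n k (x ∷ S) f ⟩
  ∑ (pick (x ∷ S)) (λ (j , T) → ∑ (allVecs n k) (λ v → draws Fin._≟_ T (toList v) * f (j ∷ toList v)))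
    ≡⟨ ∑-cong-All (pick (x ∷ S)) (All.map (λ {(j , T)} e′ →
         allVecs-draws n k T (ℕ.suc-injective (trans e′ e)) (λ w → f (j ∷ w))) (pick-length (x ∷ S))) ⟩
  ∑ (pick (x ∷ S)) (λ (j , T) → ∑ (perms T) (λ w → f (j ∷ w)))
    ≡⟨ perms-pick x S f ⟨
  ∑ (perms (x ∷ S)) f ∎

∑-Sym : ∀ n (f : List (Fin n) → ℚ) → ∑ (Sym n) (λ σ → f (toList σ)) ≡ ∑ (perms (allFin n)) f
∑-Sym n f = begin
  ∑ (Sym n) (λ σ → f (toList σ))
    ≡⟨ ∑-filter (λ σ → unique? (toList σ)) (allVecs n n) (λ σ → f (toList σ)) ⟩
  ∑ (allVecs n n) (λ σ → indicator (unique? (toList σ)) * f (toList σ))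
    ≡⟨ ∑-cong (allVecs n n) (λ σ → cong (_* f (toList σ)) (unique-draws (toList σ))) ⟩
  ∑ (allVecs n n) (λ σ → draws Fin._≟_ (allFin n) (toList σ) * f (toList σ))
    ≡⟨ allVecs-draws n n (allFin n) (length-tabulate (λ i → i)) f ⟩
  ∑ (perms (allFin n)) f ∎
  where
  open UniqueDec (Fin._≟_ {n}) using (unique?)

  -- Every entry lies in `allFin n`, so drawing from it tests distinctness alone.
  unique-draws : ∀ v → indicator (unique? v) ≡ draws Fin._≟_ (allFin n) v
  unique-draws v with unique? v
  ... | yes uv = sym (draws-unique Fin._≟_ (Unique.allFin⁺ n) uv (All.universal ∈-allFin v))
  ... | no ¬uv = sym (draws-repeated Fin._≟_ (Unique.allFin⁺ n) v ¬uv)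

-- Evaluation of the products on test functions

module Products {A : Set} (_⋄_ : A → A → Lin A) where

  open Ops _⋄_

  ⟦letter⟧ : ∀ a f → ⟦ letter a ⟧ f ≡ f a
  ⟦letter⟧ a f = trans (+-identityʳ _) (*-identityˡ (f a))

  ⟦⋄ₗ⟧ : ∀ p q g → ⟦ p ⋄ₗ q ⟧ g ≡ ⟦ p ⟧ (λ a → ⟦ q ⟧ (λ b → ⟦ a ⋄ b ⟧ g))
  ⟦⋄ₗ⟧ p q g = ⟦⟧-concatMap _ p _ g λ c a →
    trans (⟦⟧-concatMap _ q (λ b → c * ⟦ a ⋄ b ⟧ g) g λ d b →
            trans (⟦⟧-scale (c * d) (a ⋄ b) g)
                  (solve 3 (λ c d x → (c :* d) :* x := d :* (c :* x)) refl c d (⟦ a ⋄ b ⟧ g)))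
          (⟦⟧-* q c _)

  ⟦·⟧ : ∀ p q g → ⟦ p · q ⟧ g ≡ ⟦ p ⟧ (λ w → ⟦ q ⟧ (λ v → g (w ++ v)))
  ⟦·⟧ p q g = ⟦⟧-concatMap _ p _ g λ c w →
    trans (∑-map _ q _)
      (trans (∑-cong q (λ (d , v) → *-assoc c d (g (w ++ v)))) (∑-* q c _))

  ⟦letterPoly·⟧ : ∀ p q g → ⟦ letterPoly p · q ⟧ g ≡ ⟦ p ⟧ (λ a → ⟦ q ⟧ (λ v → g (a ∷ v)))
  ⟦letterPoly·⟧ p q g = trans (⟦·⟧ (letterPoly p) q g) (∑-map _ p _)

  ⟦⊛ₚ⟧ : ∀ p q g → ⟦ p ⊛ₚ q ⟧ g ≡ ⟦ p ⟧ (λ w → ⟦ q ⟧ (λ v → ⟦ w ⊛ v ⟧ g))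
  ⟦⊛ₚ⟧ p q g = ⟦⟧-concatMap _ p _ g λ c w →
    trans (⟦⟧-concatMap _ q (λ v → c * ⟦ w ⊛ v ⟧ g) g λ d v →
            trans (⟦⟧-scale (c * d) (w ⊛ v) g)
                  (solve 3 (λ c d x → (c :* d) :* x := d :* (c :* x)) refl c d (⟦ w ⊛ v ⟧ g)))
          (⟦⟧-* q c _)

  ⟦Σ^ₚ⟧ : ∀ s p g → ⟦ Σ^ₚ s p ⟧ g ≡ ⟦ p ⟧ (λ w → ⟦ Σ^ s w ⟧ g)
  ⟦Σ^ₚ⟧ s p g = ⟦⟧-concatMap _ p _ g (λ c w → ⟦⟧-scale c (Σ^ s w) g)

-- Quasi-shuffle multiplication by a single letter

module Commutative {A : Set} (_⋄_ : A → A → Lin A)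
  (⋄-comm  : ∀ a b g → ⟦ a ⋄ b ⟧ g ≡ ⟦ b ⋄ a ⟧ g)
  (⋄-assoc : ∀ a b c g → ⟦ a ⋄ b ⟧ (λ x → ⟦ x ⋄ c ⟧ g) ≡ ⟦ b ⋄ c ⟧ (λ x → ⟦ a ⋄ x ⟧ g))
  where

  open Ops _⋄_
  open Products _⋄_

  ⋄-leftComm : ∀ a b c g → ⟦ b ⋄ c ⟧ (λ x → ⟦ a ⋄ x ⟧ g) ≡ ⟦ a ⋄ c ⟧ (λ x → ⟦ b ⋄ x ⟧ g)
  ⋄-leftComm a b c g = begin
    ⟦ b ⋄ c ⟧ (λ x → ⟦ a ⋄ x ⟧ g)  ≡⟨ ⋄-assoc a b c g ⟨
    ⟦ a ⋄ b ⟧ (λ x → ⟦ x ⋄ c ⟧ g)  ≡⟨ ⋄-comm a b _ ⟩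
    ⟦ b ⋄ a ⟧ (λ x → ⟦ x ⋄ c ⟧ g)  ≡⟨ ⋄-assoc b a c g ⟩
    ⟦ a ⋄ c ⟧ (λ x → ⟦ b ⋄ x ⟧ g)  ∎

  ⋄-rightComm : ∀ a b c g → ⟦ a ⋄ b ⟧ (λ x → ⟦ x ⋄ c ⟧ g) ≡ ⟦ a ⋄ c ⟧ (λ x → ⟦ x ⋄ b ⟧ g)
  ⋄-rightComm a b c g = begin
    ⟦ a ⋄ b ⟧ (λ x → ⟦ x ⋄ c ⟧ g)  ≡⟨ ⋄-assoc a b c g ⟩
    ⟦ b ⋄ c ⟧ (λ x → ⟦ a ⋄ x ⟧ g)  ≡⟨ ⋄-comm b c _ ⟩
    ⟦ c ⋄ b ⟧ (λ x → ⟦ a ⋄ x ⟧ g)  ≡⟨ ⋄-assoc a c b g ⟨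
    ⟦ a ⋄ c ⟧ (λ x → ⟦ x ⋄ b ⟧ g)  ∎

  ⊛-[] : ∀ a g → ⟦ (a ∷ []) ⊛ [] ⟧ g ≡ g (a ∷ [])
  ⊛-[] a g = trans (+-identityʳ _) (*-identityˡ _)

  ⊛-∷ : ∀ a b v g → ⟦ (a ∷ []) ⊛ (b ∷ v) ⟧ g ≡
    (g (a ∷ b ∷ v) + ⟦ (a ∷ []) ⊛ v ⟧ (λ w → g (b ∷ w))) + ⟦ a ⋄ b ⟧ (λ c → g (c ∷ v))
  ⊛-∷ a b v g = begin
    ⟦ l₁ ++ l₂ ++ l₃ ⟧ g                 ≡⟨ ⟦⟧-++ l₁ (l₂ ++ l₃) g ⟩
    ⟦ l₁ ⟧ g + ⟦ l₂ ++ l₃ ⟧ g            ≡⟨ cong (⟦ l₁ ⟧ g +_) (⟦⟧-++ l₂ l₃ g) ⟩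
    ⟦ l₁ ⟧ g + (⟦ l₂ ⟧ g + ⟦ l₃ ⟧ g)     ≡⟨ +-assoc (⟦ l₁ ⟧ g) (⟦ l₂ ⟧ g) (⟦ l₃ ⟧ g) ⟨
    (⟦ l₁ ⟧ g + ⟦ l₂ ⟧ g) + ⟦ l₃ ⟧ g     ≡⟨ cong₂ _+_ (cong₂ _+_ e₁ e₂) e₃ ⟩
    (g (a ∷ b ∷ v) + ⟦ (a ∷ []) ⊛ v ⟧ (λ w → g (b ∷ w))) + ⟦ a ⋄ b ⟧ (λ c → g (c ∷ v)) ∎
    where
    l₁ = letterPoly (letter a) · ([] ⊛ (b ∷ v))
    l₂ = letterPoly (letter b) · ((a ∷ []) ⊛ v)
    l₃ = letterPoly (a ⋄ b) · ([] ⊛ v)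

    unit : ∀ (w : Word) f → ⟦ [] ⊛ w ⟧ f ≡ f w
    unit w f = trans (+-identityʳ _) (*-identityˡ (f w))

    e₁ : ⟦ l₁ ⟧ g ≡ g (a ∷ b ∷ v)
    e₁ = trans (⟦letterPoly·⟧ (letter a) ([] ⊛ (b ∷ v)) g)
           (trans (⟦letter⟧ a (λ a → ⟦ [] ⊛ (b ∷ v) ⟧ (λ w → g (a ∷ w)))) (unit (b ∷ v) (λ w → g (a ∷ w))))

    e₂ : ⟦ l₂ ⟧ g ≡ ⟦ (a ∷ []) ⊛ v ⟧ (λ w → g (b ∷ w))
    e₂ = trans (⟦letterPoly·⟧ (letter b) ((a ∷ []) ⊛ v) g)
           (⟦letter⟧ b (λ b → ⟦ (a ∷ []) ⊛ v ⟧ (λ w → g (b ∷ w))))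

    e₃ : ⟦ l₃ ⟧ g ≡ ⟦ a ⋄ b ⟧ (λ c → g (c ∷ v))
    e₃ = trans (⟦letterPoly·⟧ (a ⋄ b) ([] ⊛ v) g)
           (⟦⟧-cong (a ⋄ b) (λ c → unit v (λ w → g (c ∷ w))))

  absorb : A → (Word → ℚ) → Word → ℚ
  absorb x g w = ∑ (places w) (λ (p , b , q) → ⟦ x ⋄ b ⟧ (λ c → g (p ++ c ∷ q)))

  absorb-∷ : ∀ x g a w → absorb x g (a ∷ w) ≡
    ⟦ x ⋄ a ⟧ (λ c → g (c ∷ w)) + absorb x (λ v → g (a ∷ v)) w
  absorb-∷ x g a w = places-∷ a w (λ p b q → ⟦ x ⋄ b ⟧ (λ c → g (p ++ c ∷ q)))

  absorb-cong : ∀ x {f g} → (∀ w → f w ≡ g w) → ∀ w → absorb x f w ≡ absorb x g w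
  absorb-cong x e w =
    ∑-cong (places w) (λ (p , b , q) → ⟦⟧-cong (x ⋄ b) (λ c → e (p ++ c ∷ q)))

  absorb-+ : ∀ x f g w → absorb x (λ v → f v + g v) w ≡ absorb x f w + absorb x g w
  absorb-+ x f g w =
    trans (∑-cong (places w) (λ (p , b , q) → ⟦⟧-+ (x ⋄ b) _ _)) (∑-+ (places w) _ _)

  absorb-* : ∀ x s g w → absorb x (λ v → s * g v) w ≡ s * absorb x g w
  absorb-* x s g w =
    trans (∑-cong (places w) (λ (p , b , q) → ⟦⟧-* (x ⋄ b) s _)) (∑-* (places w) s _)

  absorb-⟦⟧ : ∀ x (p : Lin X) (g : X → Word → ℚ) w →
    absorb x (λ v → ⟦ p ⟧ (λ y → g y v)) w ≡ ⟦ p ⟧ (λ y → absorb x (g y) w)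
  absorb-⟦⟧ x p g w = sym
    (trans (⟦⟧-∑ p (places w) _) (∑-cong (places w) (λ (_ , b , _) → ⟦⟧-swap p (x ⋄ b) _)))

  insert-* : ∀ (x : A) s g w → insert x (λ v → s * g v) w ≡ s * insert x g w
  insert-* x s g w = ∑-* (cuts w) s _

  insert-⟦⟧ : ∀ (x : A) (p : Lin X) (g : X → Word → ℚ) w →
    insert x (λ v → ⟦ p ⟧ (λ y → g y v)) w ≡ ⟦ p ⟧ (λ y → insert x (g y) w)
  insert-⟦⟧ x p g w = sym (⟦⟧-∑ p (cuts w) _)

  -- A single letter is either placed between the letters of `w` or multiplied into exactly one of
  -- them.
  ⊛≡insert+absorb : ∀ a w g → ⟦ (a ∷ []) ⊛ w ⟧ g ≡ insert a g w + absorb a g w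
  ⊛≡insert+absorb a [] g =
    trans (⊛-[] a g) (solve 1 (λ x → x := (x :+ con 0ℚ) :+ con 0ℚ) refl (g (a ∷ [])))
  ⊛≡insert+absorb a (b ∷ v) g = begin
    ⟦ (a ∷ []) ⊛ (b ∷ v) ⟧ g
      ≡⟨ ⊛-∷ a b v g ⟩
    (x + ⟦ (a ∷ []) ⊛ v ⟧ (λ w → g (b ∷ w))) + y
      ≡⟨ cong (λ z → (x + z) + y) (⊛≡insert+absorb a v _) ⟩
    (x + (i + j)) + y
      ≡⟨ solve 4 (λ x i j y → (x :+ (i :+ j)) :+ y := (x :+ i) :+ (y :+ j)) refl x i j y ⟩
    (x + i) + (y + j)
      ≡⟨ cong₂ _+_ (insert-∷ a g b v) (absorb-∷ a g b v) ⟨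
    insert a g (b ∷ v) + absorb a g (b ∷ v) ∎
    where
    x = g (a ∷ b ∷ v)
    y = ⟦ a ⋄ b ⟧ (λ c → g (c ∷ v))
    i = insert a (λ w → g (b ∷ w)) v
    j = absorb a (λ w → g (b ∷ w)) v

  -- This allows the blocks of a partition to be reordered. Of the eleven terms in `expand`, eight
  -- are exchanged in pairs when `a` and `b` are swapped. In the other three, `a` meets `b`
  -- (`⋄-comm`), both meet `c` (`⋄-leftComm`), or both go into the tail (induction).
  ⊛-leftComm : ∀ a b w g →
    ⟦ (b ∷ []) ⊛ w ⟧ (λ v → ⟦ (a ∷ []) ⊛ v ⟧ g) ≡ ⟦ (a ∷ []) ⊛ w ⟧ (λ v → ⟦ (b ∷ []) ⊛ v ⟧ g)
  ⊛-leftComm a b [] g = begin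
    ⟦ (b ∷ []) ⊛ [] ⟧ (λ v → ⟦ (a ∷ []) ⊛ v ⟧ g)  ≡⟨ expand a b ⟩
    (x + y) + ⟦ a ⋄ b ⟧ (λ c → g (c ∷ []))        ≡⟨ cong₂ _+_ (+-comm x y) (⋄-comm a b _) ⟩
    (y + x) + ⟦ b ⋄ a ⟧ (λ c → g (c ∷ []))        ≡⟨ expand b a ⟨
    ⟦ (a ∷ []) ⊛ [] ⟧ (λ v → ⟦ (b ∷ []) ⊛ v ⟧ g)  ∎
    where
    x = g (a ∷ b ∷ [])
    y = g (b ∷ a ∷ [])
    expand : ∀ a b → ⟦ (b ∷ []) ⊛ [] ⟧ (λ v → ⟦ (a ∷ []) ⊛ v ⟧ g) ≡
      (g (a ∷ b ∷ []) + g (b ∷ a ∷ [])) + ⟦ a ⋄ b ⟧ (λ c → g (c ∷ []))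
    expand a b = trans (⊛-[] b (λ v → ⟦ (a ∷ []) ⊛ v ⟧ g)) (trans (⊛-∷ a b [] g)
      (cong (λ z → (g (a ∷ b ∷ []) + z) + ⟦ a ⋄ b ⟧ (λ c → g (c ∷ []))) (⊛-[] a (λ v → g (b ∷ v)))))
  ⊛-leftComm a b (c ∷ v) g = begin
    ⟦ (b ∷ []) ⊛ (c ∷ v) ⟧ (λ w → ⟦ (a ∷ []) ⊛ w ⟧ g)
      ≡⟨ expand a b ⟩
    ((w a b + (w b a + t b a + u b a)) + m a b) + (t a b + ⟦ (b ∷ []) ⊛ v ⟧ (λ v′ → ⟦ (a ∷ []) ⊛ v′ ⟧ g′) + n a b)
      + (u a b + n b a + k a b)
      ≡⟨ cong₂ (λ x y → x + y + (u a b + n b a + k a b))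
           (cong ((w a b + (w b a + t b a + u b a)) +_) (⋄-comm a b _))
           (cong (λ x → t a b + x + n a b) (⊛-leftComm a b v g′)) ⟩
    ((w a b + (w b a + t b a + u b a)) + m b a) + (t a b + ⟦ (a ∷ []) ⊛ v ⟧ (λ v′ → ⟦ (b ∷ []) ⊛ v′ ⟧ g′) + n a b)
      + (u a b + n b a + k a b)
      ≡⟨ solve 11 (λ wab wba tba uba m tab i nab uab nba k →
           ((wab :+ (wba :+ tba :+ uba)) :+ m) :+ (tab :+ i :+ nab) :+ (uab :+ nba :+ k) :=
           ((wba :+ (wab :+ tab :+ uab)) :+ m) :+ (tba :+ i :+ nba) :+ (uba :+ nab :+ k)) refl
           (w a b) (w b a) (t b a) (u b a) (m b a) (t a b)
           (⟦ (a ∷ []) ⊛ v ⟧ (λ v′ → ⟦ (b ∷ []) ⊛ v′ ⟧ g′)) (n a b) (u a b) (n b a) (k a b) ⟩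
    ((w b a + (w a b + t a b + u a b)) + m b a) + (t b a + ⟦ (a ∷ []) ⊛ v ⟧ (λ v′ → ⟦ (b ∷ []) ⊛ v′ ⟧ g′) + n b a)
      + (u b a + n a b + k a b)
      ≡⟨ cong (λ x → ((w b a + (w a b + t a b + u a b)) + m b a)
                 + (t b a + ⟦ (a ∷ []) ⊛ v ⟧ (λ v′ → ⟦ (b ∷ []) ⊛ v′ ⟧ g′) + n b a)
                 + (u b a + n a b + x)) (⋄-leftComm a b c _) ⟩
    ((w b a + (w a b + t a b + u a b)) + m b a) + (t b a + ⟦ (a ∷ []) ⊛ v ⟧ (λ v′ → ⟦ (b ∷ []) ⊛ v′ ⟧ g′) + n b a)
      + (u b a + n a b + k b a)
      ≡⟨ expand b a ⟨
    ⟦ (a ∷ []) ⊛ (c ∷ v) ⟧ (λ w → ⟦ (b ∷ []) ⊛ w ⟧ g) ∎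
    where
    g′ : Word → ℚ
    g′ w = g (c ∷ w)
    w t u m n k : A → A → ℚ
    w a b = g (a ∷ b ∷ c ∷ v)
    t a b = ⟦ (b ∷ []) ⊛ v ⟧ (λ v → g (a ∷ c ∷ v))
    u a b = ⟦ b ⋄ c ⟧ (λ d → g (a ∷ d ∷ v))
    m a b = ⟦ a ⋄ b ⟧ (λ d → g (d ∷ c ∷ v))
    n a b = ⟦ a ⋄ c ⟧ (λ d → ⟦ (b ∷ []) ⊛ v ⟧ (λ v′ → g (d ∷ v′)))
    k a b = ⟦ b ⋄ c ⟧ (λ d → ⟦ a ⋄ d ⟧ (λ e → g (e ∷ v)))

    expand : ∀ a b → ⟦ (b ∷ []) ⊛ (c ∷ v) ⟧ (λ w → ⟦ (a ∷ []) ⊛ w ⟧ g) ≡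
      ((w a b + (w b a + t b a + u b a)) + m a b)
      + (t a b + ⟦ (b ∷ []) ⊛ v ⟧ (λ v′ → ⟦ (a ∷ []) ⊛ v′ ⟧ g′) + n a b)
      + (u a b + n b a + k a b)
    expand a b = trans (⊛-∷ b c v (λ w → ⟦ (a ∷ []) ⊛ w ⟧ g)) (cong₂ _+_ (cong₂ _+_
      (trans (⊛-∷ a b (c ∷ v) g) (cong (λ z → (w a b + z) + m a b) (⊛-∷ a c v (λ w → g (b ∷ w)))))
      (begin
        ⟦ B ⟧ (λ v′ → ⟦ (a ∷ []) ⊛ (c ∷ v′) ⟧ g)
          ≡⟨ ⟦⟧-cong B (λ v′ → ⊛-∷ a c v′ g) ⟩
        ⟦ B ⟧ (λ v′ → g (a ∷ c ∷ v′) + ⟦ (a ∷ []) ⊛ v′ ⟧ g′ + ⟦ a ⋄ c ⟧ (λ d → g (d ∷ v′)))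
          ≡⟨ ⟦⟧-+ B _ _ ⟩
        ⟦ B ⟧ (λ v′ → g (a ∷ c ∷ v′) + ⟦ (a ∷ []) ⊛ v′ ⟧ g′) + ⟦ B ⟧ (λ v′ → ⟦ a ⋄ c ⟧ (λ d → g (d ∷ v′)))
          ≡⟨ cong₂ _+_ (⟦⟧-+ B _ _) (⟦⟧-swap B (a ⋄ c) _) ⟩
        t a b + ⟦ B ⟧ (λ v′ → ⟦ (a ∷ []) ⊛ v′ ⟧ g′) + n a b ∎))
      (begin
        ⟦ b ⋄ c ⟧ (λ d → ⟦ (a ∷ []) ⊛ (d ∷ v) ⟧ g)
          ≡⟨ ⟦⟧-cong (b ⋄ c) (λ d → ⊛-∷ a d v g) ⟩
        ⟦ b ⋄ c ⟧ (λ d → g (a ∷ d ∷ v) + ⟦ (a ∷ []) ⊛ v ⟧ (λ v′ → g (d ∷ v′)) + ⟦ a ⋄ d ⟧ (λ e → g (e ∷ v)))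
          ≡⟨ ⟦⟧-+ (b ⋄ c) _ _ ⟩
        ⟦ b ⋄ c ⟧ (λ d → g (a ∷ d ∷ v) + ⟦ (a ∷ []) ⊛ v ⟧ (λ v′ → g (d ∷ v′))) + k a b
          ≡⟨ cong (_+ k a b) (⟦⟧-+ (b ⋄ c) _ _) ⟩
        u a b + n b a + k a b ∎))
      where B = (b ∷ []) ⊛ v

  fuse : A → List A → (A → ℚ) → ℚ
  fuse a []       f = f a
  fuse a (b ∷ bs) f = ⟦ a ⋄ b ⟧ (λ c → fuse c bs f)

  ⟦dia⟧ : ∀ a bs f → ⟦ dia (a ∷ bs) ⟧ f ≡ fuse a bs f
  ⟦dia⟧ a bs f = trans (go (letter a) bs) (⟦letter⟧ a (λ a → fuse a bs f))
    where
    go : ∀ p bs → ⟦ foldl (λ acc b → acc ⋄ₗ letter b) p bs ⟧ f ≡ ⟦ p ⟧ (λ a → fuse a bs f)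
    go p []       = refl
    go p (b ∷ bs) = begin
      ⟦ foldl (λ acc b → acc ⋄ₗ letter b) (p ⋄ₗ letter b) bs ⟧ f
        ≡⟨ go (p ⋄ₗ letter b) bs ⟩
      ⟦ p ⋄ₗ letter b ⟧ (λ c → fuse c bs f)
        ≡⟨ ⟦⋄ₗ⟧ p (letter b) _ ⟩
      ⟦ p ⟧ (λ a → ⟦ letter b ⟧ (λ b → ⟦ a ⋄ b ⟧ (λ c → fuse c bs f)))
        ≡⟨ ⟦⟧-cong p (λ a → ⟦letter⟧ b (λ b → ⟦ a ⋄ b ⟧ (λ c → fuse c bs f))) ⟩
      ⟦ p ⟧ (λ a → ⟦ a ⋄ b ⟧ (λ c → fuse c bs f)) ∎

  fuse-assoc : ∀ a b bs f → ⟦ a ⋄ b ⟧ (λ c → fuse c bs f) ≡ fuse b bs (λ d → ⟦ a ⋄ d ⟧ f)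
  fuse-assoc a b []       f = refl
  fuse-assoc a b (c ∷ bs) f =
    trans (⋄-assoc a b c _) (⟦⟧-cong (b ⋄ c) (λ x → fuse-assoc a x bs f))

  -- `dia` multiplies a block from left to right, but `segs` enlarges it at its left end;
  -- associativity lets the new first letter be multiplied in last.
  ⟦dia⟧-∷ : ∀ a b bs f → ⟦ dia (a ∷ b ∷ bs) ⟧ f ≡ ⟦ dia (b ∷ bs) ⟧ (λ d → ⟦ a ⋄ d ⟧ f)
  ⟦dia⟧-∷ a b bs f =
    trans (⟦dia⟧ a (b ∷ bs) f) (trans (fuse-assoc a b bs f) (sym (⟦dia⟧ b bs _)))

  -- The operator `Σ^` as a recursion over letters

  merge : A → (Word → ℚ) → Word → ℚ
  merge a g []      = 0ℚ
  merge a g (b ∷ v) = ⟦ a ⋄ b ⟧ (λ c → g (c ∷ v))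

  -- Transpose of putting `a` in front of a word whose letters are finished blocks: `a` is a block
  -- by itself or, at cost `s`, joins the first block. In front of the empty word there is nothing
  -- to join, whence the value 0 of `merge`.
  extend : ℚ → A → (Word → ℚ) → Word → ℚ
  extend s a g v = g (a ∷ v) + s * merge a g v

  ⟦⟧-extend : ∀ p s a g →
    ⟦ p ⟧ (extend s a g) ≡ ⟦ p ⟧ (λ v → g (a ∷ v)) + s * ⟦ p ⟧ (merge a g)
  ⟦⟧-extend p s a g = trans (⟦⟧-+ p _ _) (cong (⟦ p ⟧ (λ v → g (a ∷ v)) +_) (⟦⟧-* p s _))

  -- Keeps the exponent `length w ∸ length S` free of truncation.
  segs-length : ∀ w → All (λ S → length S ℕ.≤ length w) (segs w)
  segs-length []      = z≤n ∷ []
  segs-length (a ∷ w) = All.concat⁺ (All.map⁺ (All.map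
    (λ { {[]}    le → s≤s z≤n ∷ []
       ; {B ∷ S} le → s≤s le ∷ ℕ.≤-trans le (ℕ.n≤1+n (length w)) ∷ [] })
    (segs-length w)))

  evalSeg-singleton : ∀ a S g → ⟦ evalSeg ((a ∷ []) ∷ S) ⟧ g ≡ ⟦ evalSeg S ⟧ (λ v → g (a ∷ v))
  evalSeg-singleton a S g = trans (⟦letterPoly·⟧ (letter a) (evalSeg S) g)
    (⟦letter⟧ a (λ a → ⟦ evalSeg S ⟧ (λ v → g (a ∷ v))))

  evalSeg-merge : ∀ a B S g →
    ⟦ evalSeg ((a ∷ List⁺.toList B) ∷ S) ⟧ g ≡ ⟦ evalSeg (B ∷ S) ⟧ (merge a g)
  evalSeg-merge a (b ∷ bs) S g = begin
    ⟦ evalSeg ((a ∷ b ∷ bs) ∷ S) ⟧ g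
      ≡⟨ ⟦letterPoly·⟧ (dia (a ∷ b ∷ bs)) (evalSeg S) g ⟩
    ⟦ dia (a ∷ b ∷ bs) ⟧ (λ c → ⟦ evalSeg S ⟧ (λ v → g (c ∷ v)))
      ≡⟨ ⟦dia⟧-∷ a b bs _ ⟩
    ⟦ dia (b ∷ bs) ⟧ (λ d → ⟦ a ⋄ d ⟧ (λ c → ⟦ evalSeg S ⟧ (λ v → g (c ∷ v))))
      ≡⟨ ⟦⟧-cong (dia (b ∷ bs)) (λ d → ⟦⟧-swap (a ⋄ d) (evalSeg S) _) ⟩
    ⟦ dia (b ∷ bs) ⟧ (λ d → ⟦ evalSeg S ⟧ (λ v → merge a g (d ∷ v)))
      ≡⟨ ⟦letterPoly·⟧ (dia (b ∷ bs)) (evalSeg S) (merge a g) ⟨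
    ⟦ evalSeg ((b ∷ bs) ∷ S) ⟧ (merge a g) ∎

  -- A composition of the longer word arises by adding a singleton in front or by enlarging the
  -- first block; the latter adds a letter but no block, hence one more factor `s`. Together with
  -- the value at the empty word, this is all that is used about compositions afterwards.
  ⟦Σ^⟧-∷ : ∀ s a w g → ⟦ Σ^ s (a ∷ w) ⟧ g ≡ ⟦ Σ^ s w ⟧ (extend s a g)
  ⟦Σ^⟧-∷ s a w g =
    trans (∑-concatMap _ (segs (a ∷ w)) _)
    (trans (∑-concatMap _ (segs w) _)
    (trans (∑-cong-All (segs w) (All.map
      (λ { {[]}    le → trans (nil (s ^ℚ length w)) (sym (⟦⟧-scale (s ^ℚ length w) one (extend s a g)))
         ; {B ∷ S} le → cons B S le })
      (segs-length w)))
    (sym (∑-concatMap _ (segs w) _))))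
    where
    n = length w

    nil : ∀ c → ⟦ scale c (evalSeg ((a ∷ []) ∷ [])) ⟧ g + 0ℚ ≡ c * ⟦ one ⟧ (extend s a g)
    nil c = begin
      ⟦ scale c (evalSeg ((a ∷ []) ∷ [])) ⟧ g + 0ℚ
        ≡⟨ cong (_+ 0ℚ) (⟦⟧-scale c (evalSeg ((a ∷ []) ∷ [])) g) ⟩
      c * ⟦ evalSeg ((a ∷ []) ∷ []) ⟧ g + 0ℚ
        ≡⟨ cong (λ z → c * z + 0ℚ) (evalSeg-singleton a [] g) ⟩
      c * ⟦ one ⟧ (λ v → g (a ∷ v)) + 0ℚ
        ≡⟨ solve 3 (λ c s x → c :* (con 1ℚ :* x :+ con 0ℚ) :+ con 0ℚ :=
             c :* (con 1ℚ :* (x :+ s :* con 0ℚ) :+ con 0ℚ)) refl c s (g (a ∷ [])) ⟩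
      c * ⟦ one ⟧ (extend s a g) ∎

    cons : ∀ B S → suc (length S) ℕ.≤ n →
      ⟦ scale (s ^ℚ (n ∸ suc (length S))) (evalSeg ((a ∷ []) ∷ B ∷ S)) ⟧ g
        + (⟦ scale (s ^ℚ (n ∸ length S)) (evalSeg ((a ∷ List⁺.toList B) ∷ S)) ⟧ g + 0ℚ)
        ≡ ⟦ scale (s ^ℚ (n ∸ suc (length S))) (evalSeg (B ∷ S)) ⟧ (extend s a g)
    cons B S le = begin
      ⟦ scale c (evalSeg ((a ∷ []) ∷ B ∷ S)) ⟧ g
        + (⟦ scale (s ^ℚ (n ∸ length S)) (evalSeg ((a ∷ List⁺.toList B) ∷ S)) ⟧ g + 0ℚ)
        ≡⟨ cong₂ (λ x y → x + (y + 0ℚ))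
             (trans (⟦⟧-scale c (evalSeg ((a ∷ []) ∷ B ∷ S)) g)
                    (cong (c *_) (evalSeg-singleton a (B ∷ S) g)))
             (trans (⟦⟧-scale (s ^ℚ (n ∸ length S)) (evalSeg ((a ∷ List⁺.toList B) ∷ S)) g)
                    (cong₂ _*_ (cong (s ^ℚ_) (ℕ.+-∸-assoc 1 le)) (evalSeg-merge a B S g))) ⟩
      c * x + (s * c * y + 0ℚ)
        ≡⟨ solve 4 (λ c s x y → c :* x :+ (s :* c :* y :+ con 0ℚ) := c :* (x :+ s :* y)) refl c s x y ⟩
      c * (x + s * y)
        ≡⟨ cong (c *_) (⟦⟧-extend (evalSeg (B ∷ S)) s a g) ⟨
      c * ⟦ evalSeg (B ∷ S) ⟧ (extend s a g)
        ≡⟨ ⟦⟧-scale c (evalSeg (B ∷ S)) (extend s a g) ⟨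
      ⟦ scale c (evalSeg (B ∷ S)) ⟧ (extend s a g) ∎
      where
      c = s ^ℚ (n ∸ suc (length S))
      x = ⟦ evalSeg (B ∷ S) ⟧ (λ v → g (a ∷ v))
      y = ⟦ evalSeg (B ∷ S) ⟧ (merge a g)

  ⟦Σ^⟧-[] : ∀ s g → ⟦ Σ^ s [] ⟧ g ≡ g []
  ⟦Σ^⟧-[] s g = solve 1 (λ x → (con 1ℚ :* con 1ℚ) :* x :+ con 0ℚ := x) refl (g [])

  ⟦Σ^⟧-letter : ∀ s a g → ⟦ Σ^ s (a ∷ []) ⟧ g ≡ g (a ∷ [])
  ⟦Σ^⟧-letter s a g = trans (⟦Σ^⟧-∷ s a [] g) (trans (⟦Σ^⟧-[] s (extend s a g))
    (trans (cong (g (a ∷ []) +_) (*-zeroʳ s)) (+-identityʳ (g (a ∷ [])))))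

  merge-merge : ∀ a b g v → ⟦ a ⋄ b ⟧ (λ c → merge c g v) ≡ merge b (merge a g) v
  merge-merge a b g []      = ⟦⟧-0 (a ⋄ b)
  merge-merge a b g (d ∷ v) = ⋄-assoc a b d _

  extend-merge : ∀ s a b g v → ⟦ a ⋄ b ⟧ (λ c → extend s c g v) ≡ extend s b (merge a g) v
  extend-merge s a b g v = trans (⟦⟧-+ (a ⋄ b) _ _)
    (cong (⟦ a ⋄ b ⟧ (λ c → g (c ∷ v)) +_)
      (trans (⟦⟧-* (a ⋄ b) s _) (cong (s *_) (merge-merge a b g v))))

  -- The first letter of a word is a factor of its first block, so by associativity `a` may be
  -- multiplied in before or after the cutting.
  ⟦Σ^⟧-merge : ∀ s a g v → merge a (λ w → ⟦ Σ^ s w ⟧ g) v ≡ ⟦ Σ^ s v ⟧ (merge a g)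
  ⟦Σ^⟧-merge s a g [] = sym (⟦Σ^⟧-[] s (merge a g))
  ⟦Σ^⟧-merge s a g (b ∷ v) = begin
    ⟦ a ⋄ b ⟧ (λ c → ⟦ Σ^ s (c ∷ v) ⟧ g)           ≡⟨ ⟦⟧-cong (a ⋄ b) (λ c → ⟦Σ^⟧-∷ s c v g) ⟩
    ⟦ a ⋄ b ⟧ (λ c → ⟦ Σ^ s v ⟧ (extend s c g))    ≡⟨ ⟦⟧-swap (a ⋄ b) (Σ^ s v) _ ⟩
    ⟦ Σ^ s v ⟧ (λ w → ⟦ a ⋄ b ⟧ (λ c → extend s c g w))
                                                   ≡⟨ ⟦⟧-cong (Σ^ s v) (extend-merge s a b g) ⟩
    ⟦ Σ^ s v ⟧ (extend s b (merge a g))            ≡⟨ ⟦Σ^⟧-∷ s b v (merge a g) ⟨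
    ⟦ Σ^ s (b ∷ v) ⟧ (merge a g)                   ∎

  -- A letter joins its right neighbour either in the first pass, at cost `s`, or in the second, at
  -- cost `t`; the costs add up.
  ⟦Σ^⟧-∘ : ∀ s t w g → ⟦ Σ^ s w ⟧ (λ v → ⟦ Σ^ t v ⟧ g) ≡ ⟦ Σ^ (s + t) w ⟧ g
  ⟦Σ^⟧-∘ s t [] g =
    trans (⟦Σ^⟧-[] s (λ v → ⟦ Σ^ t v ⟧ g)) (trans (⟦Σ^⟧-[] t g) (sym (⟦Σ^⟧-[] (s + t) g)))
  ⟦Σ^⟧-∘ s t (a ∷ w) g = begin
    ⟦ Σ^ s (a ∷ w) ⟧ (λ v → ⟦ Σ^ t v ⟧ g)              ≡⟨ ⟦Σ^⟧-∷ s a w _ ⟩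
    ⟦ Σ^ s w ⟧ (extend s a (λ v → ⟦ Σ^ t v ⟧ g))       ≡⟨ ⟦⟧-cong (Σ^ s w) step ⟩
    ⟦ Σ^ s w ⟧ (λ v → ⟦ Σ^ t v ⟧ (extend (s + t) a g)) ≡⟨ ⟦Σ^⟧-∘ s t w (extend (s + t) a g) ⟩
    ⟦ Σ^ (s + t) w ⟧ (extend (s + t) a g)              ≡⟨ ⟦Σ^⟧-∷ (s + t) a w g ⟨
    ⟦ Σ^ (s + t) (a ∷ w) ⟧ g                           ∎
    where
    step : ∀ v → extend s a (λ v → ⟦ Σ^ t v ⟧ g) v ≡ ⟦ Σ^ t v ⟧ (extend (s + t) a g)
    step v = begin
      ⟦ Σ^ t (a ∷ v) ⟧ g + s * merge a (λ w → ⟦ Σ^ t w ⟧ g) v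
        ≡⟨ cong₂ (λ x y → x + s * y)
             (trans (⟦Σ^⟧-∷ t a v g) (⟦⟧-extend (Σ^ t v) t a g)) (⟦Σ^⟧-merge t a g v) ⟩
      x + t * y + s * y
        ≡⟨ solve 4 (λ s t x y → x :+ t :* y :+ s :* y := x :+ (s :+ t) :* y) refl s t x y ⟩
      x + (s + t) * y
        ≡⟨ ⟦⟧-extend (Σ^ t v) (s + t) a g ⟨
      ⟦ Σ^ t v ⟧ (extend (s + t) a g) ∎
      where
      x = ⟦ Σ^ t v ⟧ (λ v → g (a ∷ v))
      y = ⟦ Σ^ t v ⟧ (merge a g)

  ⟦Σ^0⟧ : ∀ w g → ⟦ Σ^ 0ℚ w ⟧ g ≡ g w
  ⟦Σ^0⟧ []      g = ⟦Σ^⟧-[] 0ℚ g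
  ⟦Σ^0⟧ (a ∷ w) g = trans (⟦Σ^⟧-∷ 0ℚ a w g) (trans (⟦Σ^0⟧ w (extend 0ℚ a g))
    (trans (cong (g (a ∷ w) +_) (*-zeroˡ (merge a g w))) (+-identityʳ (g (a ∷ w)))))

  ⟦Σ^⟧-inverse : ∀ s t → s + t ≡ 0ℚ → ∀ w g → ⟦ Σ^ s w ⟧ (λ v → ⟦ Σ^ t v ⟧ g) ≡ g w
  ⟦Σ^⟧-inverse s t e w g = trans (⟦Σ^⟧-∘ s t w g)
    (trans (cong (λ s → ⟦ Σ^ s w ⟧ g) e) (⟦Σ^0⟧ w g))

  -- Inserting a letter before and after applying `Σ^ r`

  module Interpolated (r : ℚ) where

    -- Applied after Σ^r, this gives the terms of Σ^r(insertion of c) in which c is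
    -- the last letter of its block.
    insertʳ : A → (Word → ℚ) → Word → ℚ
    insertʳ c g w = insert c g w + r * absorb c g w

    absorb-merge : ∀ x a g v → absorb x (merge a g) v ≡ merge a (absorb x g) v
    absorb-merge x a g []      = refl
    absorb-merge x a g (b ∷ v) = begin
      absorb x (merge a g) (b ∷ v)
        ≡⟨ absorb-∷ x (merge a g) b v ⟩
      ⟦ x ⋄ b ⟧ (λ c → ⟦ a ⋄ c ⟧ (λ d → g (d ∷ v))) + absorb x (λ v → ⟦ a ⋄ b ⟧ (λ d → g (d ∷ v))) v
        ≡⟨ cong₂ _+_ (⋄-leftComm a x b _) (absorb-⟦⟧ x (a ⋄ b) (λ d v → g (d ∷ v)) v) ⟩
      ⟦ a ⋄ b ⟧ (λ d → ⟦ x ⋄ d ⟧ (λ e → g (e ∷ v))) + ⟦ a ⋄ b ⟧ (λ d → absorb x (λ v → g (d ∷ v)) v)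
        ≡⟨ ⟦⟧-+ (a ⋄ b) _ _ ⟨
      ⟦ a ⋄ b ⟧ (λ d → ⟦ x ⋄ d ⟧ (λ e → g (e ∷ v)) + absorb x (λ v → g (d ∷ v)) v)
        ≡⟨ ⟦⟧-cong (a ⋄ b) (λ d → absorb-∷ x g d v) ⟨
      ⟦ a ⋄ b ⟧ (λ d → absorb x g (d ∷ v)) ∎

    -- Inserting `x` and merging `a` commute unless `x` is put in front: in one order `a` then
    -- merges with `x`, in the other `x` precedes the letter into which `a` was merged. Each side is
    -- completed by the term it lacks.
    insert-merge : ∀ x a g v →
      insert x (merge a g) v + merge a (λ w → g (x ∷ w)) v
        ≡ merge a (insert x g) v + ⟦ x ⋄ a ⟧ (λ d → g (d ∷ v))
    insert-merge x a g [] =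
      trans (cong (λ z → (z + 0ℚ) + 0ℚ) (⋄-comm a x _))
        (solve 1 (λ x → (x :+ con 0ℚ) :+ con 0ℚ := con 0ℚ :+ x) refl (⟦ x ⋄ a ⟧ (λ d → g (d ∷ []))))
    insert-merge x a g (b ∷ v) = begin
      insert x (merge a g) (b ∷ v) + s
        ≡⟨ cong (_+ s) (trans (insert-∷ x (merge a g) b v)
             (cong₂ _+_ (⋄-comm a x _) (insert-⟦⟧ x (a ⋄ b) (λ d v → g (d ∷ v)) v))) ⟩
      (t + j) + s
        ≡⟨ solve 3 (λ s t j → (t :+ j) :+ s := (s :+ j) :+ t) refl s t j ⟩
      (s + j) + t
        ≡⟨ cong (_+ t) (⟦⟧-+ (a ⋄ b) (λ d → g (x ∷ d ∷ v)) (λ d → insert x (λ v → g (d ∷ v)) v)) ⟨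
      ⟦ a ⋄ b ⟧ (λ d → g (x ∷ d ∷ v) + insert x (λ v → g (d ∷ v)) v) + t
        ≡⟨ cong (_+ t) (⟦⟧-cong (a ⋄ b) (λ d → insert-∷ x g d v)) ⟨
      ⟦ a ⋄ b ⟧ (λ d → insert x g (d ∷ v)) + t ∎
      where
      s = ⟦ a ⋄ b ⟧ (λ d → g (x ∷ d ∷ v))
      t = ⟦ x ⋄ a ⟧ (λ d → g (d ∷ b ∷ v))
      j = ⟦ a ⋄ b ⟧ (λ d → insert x (λ v → g (d ∷ v)) v)

    extend-absorb : ∀ a x g v →
      extend r a (absorb x g) v ≡ ⟦ x ⋄ a ⟧ (λ c → g (c ∷ v)) + absorb x (extend r a g) v
    extend-absorb a x g v = begin
      absorb x g (a ∷ v) + r * merge a (absorb x g) v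
        ≡⟨ cong₂ (λ s t → s + r * t) (absorb-∷ x g a v) (sym (absorb-merge x a g v)) ⟩
      (s + t) + r * u
        ≡⟨ +-assoc s t (r * u) ⟩
      s + (t + r * u)
        ≡⟨ cong (s +_) (trans (absorb-+ x (λ v → g (a ∷ v)) (λ v → r * merge a g v) v)
             (cong (t +_) (absorb-* x r (merge a g) v))) ⟨
      s + absorb x (extend r a g) v ∎
      where
      s = ⟦ x ⋄ a ⟧ (λ c → g (c ∷ v))
      t = absorb x (λ v → g (a ∷ v)) v
      u = absorb x (merge a g) v

    extend-insert : ∀ a x g v →
      extend r a (insert x g) v + r * ⟦ x ⋄ a ⟧ (λ c → g (c ∷ v))
        ≡ extend r a (λ w → g (x ∷ w)) v + insert x (extend r a g) v
    extend-insert a x g v = begin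
      insert x g (a ∷ v) + r * m + r * t
        ≡⟨ cong (λ z → z + r * m + r * t) (insert-∷ x g a v) ⟩
      (s + i) + r * m + r * t
        ≡⟨ solve 5 (λ s i r m t → (s :+ i) :+ r :* m :+ r :* t := (s :+ i) :+ r :* (m :+ t)) refl s i r m t ⟩
      (s + i) + r * (m + t)
        ≡⟨ cong (λ z → (s + i) + r * z) (insert-merge x a g v) ⟨
      (s + i) + r * (j + n)
        ≡⟨ solve 5 (λ s i r j n → (s :+ i) :+ r :* (j :+ n) := (s :+ r :* n) :+ (i :+ r :* j)) refl s i r j n ⟩
      (s + r * n) + (i + r * j)
        ≡⟨ cong ((s + r * n) +_) (trans (insert-+ x (λ v → g (a ∷ v)) (λ v → r * merge a g v) v)
             (cong (i +_) (insert-* x r (merge a g) v))) ⟨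
      (s + r * n) + insert x (extend r a g) v ∎
      where
      s = g (x ∷ a ∷ v)
      i = insert x (λ v → g (a ∷ v)) v
      j = insert x (merge a g) v
      m = merge a (insert x g) v
      n = merge a (λ w → g (x ∷ w)) v
      t = ⟦ x ⋄ a ⟧ (λ c → g (c ∷ v))

    extend-+ : ∀ a f g v → extend r a (λ w → f w + g w) v ≡ extend r a f v + extend r a g v
    extend-+ a f g v = begin
      (f (a ∷ v) + g (a ∷ v)) + r * merge a (λ w → f w + g w) v
        ≡⟨ cong (λ z → (f (a ∷ v) + g (a ∷ v)) + r * z) (merge-+ v) ⟩
      (f (a ∷ v) + g (a ∷ v)) + r * (merge a f v + merge a g v)
        ≡⟨ solve 5 (λ x y r s t → (x :+ y) :+ r :* (s :+ t) := (x :+ r :* s) :+ (y :+ r :* t)) refl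
             (f (a ∷ v)) (g (a ∷ v)) r (merge a f v) (merge a g v) ⟩
      extend r a f v + extend r a g v ∎
      where
      merge-+ : ∀ v → merge a (λ w → f w + g w) v ≡ merge a f v + merge a g v
      merge-+ []      = refl
      merge-+ (b ∷ v) = ⟦⟧-+ (a ⋄ b) _ _

    extend-* : ∀ a s g v → extend r a (λ w → s * g w) v ≡ s * extend r a g v
    extend-* a s g v = begin
      s * g (a ∷ v) + r * merge a (λ w → s * g w) v
        ≡⟨ cong (λ z → s * g (a ∷ v) + r * z) (merge-* v) ⟩
      s * g (a ∷ v) + r * (s * merge a g v)
        ≡⟨ solve 4 (λ s x r m → s :* x :+ r :* (s :* m) := s :* (x :+ r :* m)) refl s (g (a ∷ v)) r (merge a g v) ⟩
      s * extend r a g v ∎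
      where
      merge-* : ∀ v → merge a (λ w → s * g w) v ≡ s * merge a g v
      merge-* []      = sym (*-zeroʳ s)
      merge-* (b ∷ v) = ⟦⟧-* (a ⋄ b) s _

    -- The term with `x ⋄ a` that `extend-insert` has to add is exactly what r times `extend-absorb`
    -- supplies; this fixes the weight r in `insertʳ`. What remains besides the commuted term is `x`
    -- standing before everything.
    extend-insertʳ : ∀ a x g v →
      extend r a (insertʳ x g) v ≡ extend r a (λ w → g (x ∷ w)) v + insertʳ x (extend r a g) v
    extend-insertʳ a x g v = begin
      extend r a (insertʳ x g) v
        ≡⟨ trans (extend-+ a (insert x g) (λ w → r * absorb x g w) v)
             (cong (extend r a (insert x g) v +_) (extend-* a r (absorb x g) v)) ⟩
      e + r * extend r a (absorb x g) v
        ≡⟨ cong (λ z → e + r * z) (extend-absorb a x g v) ⟩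
      e + r * (t + b)
        ≡⟨ solve 4 (λ e r t b → e :+ r :* (t :+ b) := (e :+ r :* t) :+ r :* b) refl e r t b ⟩
      (e + r * t) + r * b
        ≡⟨ cong (_+ r * b) (extend-insert a x g v) ⟩
      (h + i) + r * b
        ≡⟨ +-assoc h i (r * b) ⟩
      h + (i + r * b) ∎
      where
      e = extend r a (insert x g) v
      t = ⟦ x ⋄ a ⟧ (λ c → g (c ∷ v))
      b = absorb x (extend r a g) v
      h = extend r a (λ w → g (x ∷ w)) v
      i = insert x (extend r a g) v

    ⟦Σ⟧ : (Word → ℚ) → Word → ℚ
    ⟦Σ⟧ g w = ⟦ Σ^ r w ⟧ g

    -- Σ^r (p c q), restricted to the terms in which c is the last letter of its block.
    insertAt : (p : Word) (c : A) (q : Word) → (Word → ℚ) → ℚ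
    insertAt []      c q g = ⟦ Σ^ r q ⟧ (λ v → g (c ∷ v))
    insertAt (a ∷ p) c q g = insertAt p c q (extend r a g)

    ⟦Σ^⟧-insertʳ : ∀ c w g →
      ⟦ Σ^ r w ⟧ (insertʳ c g) ≡ ∑ (cuts w) (λ (p , q) → insertAt p c q g)
    ⟦Σ^⟧-insertʳ c [] g = begin
      ⟦ Σ^ r [] ⟧ (insertʳ c g)
        ≡⟨ ⟦Σ^⟧-[] r (insertʳ c g) ⟩
      (g (c ∷ []) + 0ℚ) + r * 0ℚ
        ≡⟨ solve 2 (λ x r → (x :+ con 0ℚ) :+ r :* con 0ℚ := x :+ con 0ℚ) refl (g (c ∷ [])) r ⟩
      g (c ∷ []) + 0ℚ
        ≡⟨ cong (_+ 0ℚ) (⟦Σ^⟧-[] r (λ v → g (c ∷ v))) ⟨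
      ⟦ Σ^ r [] ⟧ (λ v → g (c ∷ v)) + 0ℚ ∎
    ⟦Σ^⟧-insertʳ c (a ∷ w) g = begin
      ⟦ Σ^ r (a ∷ w) ⟧ (insertʳ c g)
        ≡⟨ ⟦Σ^⟧-∷ r a w (insertʳ c g) ⟩
      ⟦ Σ^ r w ⟧ (extend r a (insertʳ c g))
        ≡⟨ trans (⟦⟧-cong (Σ^ r w) (extend-insertʳ a c g)) (⟦⟧-+ (Σ^ r w) _ _) ⟩
      ⟦ Σ^ r w ⟧ (extend r a (λ v → g (c ∷ v))) + ⟦ Σ^ r w ⟧ (insertʳ c (extend r a g))
        ≡⟨ cong₂ _+_ (sym (⟦Σ^⟧-∷ r a w (λ v → g (c ∷ v)))) (⟦Σ^⟧-insertʳ c w (extend r a g)) ⟩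
      insertAt [] c (a ∷ w) g + ∑ (cuts w) (λ (p , q) → insertAt (a ∷ p) c q g)
        ≡⟨ cuts-∷ a w (λ p q → insertAt p c q g) ⟨
      ∑ (cuts (a ∷ w)) (λ (p , q) → insertAt p c q g) ∎

    -- If `b` is the last letter of the block that absorbs `x`, the outcome is the same as having
    -- `x ⋄ b` in place of `b`, again last in its block.
    ⟦Σ^⟧-absorb : ∀ x w g →
      ⟦ Σ^ r w ⟧ (absorb x g) ≡ ∑ (places w) (λ (p , b , q) → ⟦ x ⋄ b ⟧ (λ c → insertAt p c q g))
    ⟦Σ^⟧-absorb x []      g = ⟦Σ^⟧-[] r (absorb x g)
    ⟦Σ^⟧-absorb x (a ∷ w) g = begin
      ⟦ Σ^ r (a ∷ w) ⟧ (absorb x g)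
        ≡⟨ ⟦Σ^⟧-∷ r a w (absorb x g) ⟩
      ⟦ Σ^ r w ⟧ (extend r a (absorb x g))
        ≡⟨ trans (⟦⟧-cong (Σ^ r w) (extend-absorb a x g)) (⟦⟧-+ (Σ^ r w) _ _) ⟩
      ⟦ Σ^ r w ⟧ (λ v → ⟦ x ⋄ a ⟧ (λ c → g (c ∷ v))) + ⟦ Σ^ r w ⟧ (absorb x (extend r a g))
        ≡⟨ cong₂ _+_ (⟦⟧-swap (Σ^ r w) (x ⋄ a) _) (⟦Σ^⟧-absorb x w (extend r a g)) ⟩
      ⟦ x ⋄ a ⟧ (λ c → insertAt [] c w g)
        + ∑ (places w) (λ (p , b , q) → ⟦ x ⋄ b ⟧ (λ c → insertAt (a ∷ p) c q g))
        ≡⟨ places-∷ a w (λ p b q → ⟦ x ⋄ b ⟧ (λ c → insertAt p c q g)) ⟨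
      ∑ (places (a ∷ w)) (λ (p , b , q) → ⟦ x ⋄ b ⟧ (λ c → insertAt p c q g)) ∎

    -- Either `x` is the last letter of its block, or the next letter `b` shares the block; then the
    -- two act as the single letter `x ⋄ b`, and the word lost a letter but no block, hence the
    -- factor r.
    insert-⟦Σ^⟧ : ∀ x w g →
      insert x (⟦Σ⟧ g) w ≡ ⟦ Σ^ r w ⟧ (insertʳ x g) + r * absorb x (⟦Σ⟧ g) w
    insert-⟦Σ^⟧ x [] g = begin
      ⟦Σ⟧ g (x ∷ []) + 0ℚ                           ≡⟨ cong (_+ 0ℚ) (⟦Σ^⟧-letter r x g) ⟩
      g (x ∷ []) + 0ℚ                               ≡⟨ solve 2 (λ y r → y :+ con 0ℚ := ((y :+ con 0ℚ) :+ r :* con 0ℚ) :+ r :* con 0ℚ) refl (g (x ∷ [])) r ⟩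
      insertʳ x g [] + r * 0ℚ                       ≡⟨ cong (_+ r * 0ℚ) (⟦Σ^⟧-[] r (insertʳ x g)) ⟨
      ⟦ Σ^ r [] ⟧ (insertʳ x g) + r * 0ℚ            ∎
    insert-⟦Σ^⟧ x (a ∷ w) g = begin
      insert x (⟦Σ⟧ g) (a ∷ w)
        ≡⟨ insert-∷ x (⟦Σ⟧ g) a w ⟩
      ⟦Σ⟧ g (x ∷ a ∷ w) + insert x (λ v → ⟦Σ⟧ g (a ∷ v)) w
        ≡⟨ cong₂ _+_ lead
             (trans (insert-cong x (λ v → ⟦Σ^⟧-∷ r a v g) w) (insert-⟦Σ^⟧ x w (extend r a g))) ⟩
      (s + r * t) + (i + r * absorb x (⟦Σ⟧ (extend r a g)) w)
        ≡⟨ cong (λ z → (s + r * t) + (i + r * z)) (absorb-cong x (λ v → sym (⟦Σ^⟧-∷ r a v g)) w) ⟩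
      (s + r * t) + (i + r * u)
        ≡⟨ solve 5 (λ s r t i u → (s :+ r :* t) :+ (i :+ r :* u) := (s :+ i) :+ r :* (t :+ u)) refl s r t i u ⟩
      (s + i) + r * (t + u)
        ≡⟨ cong₂ (λ y z → y + r * z)
             (trans (⟦Σ^⟧-∷ r a w (insertʳ x g))
               (trans (⟦⟧-cong (Σ^ r w) (extend-insertʳ a x g)) (⟦⟧-+ (Σ^ r w) _ _)))
             (absorb-∷ x (⟦Σ⟧ g) a w) ⟨
      ⟦ Σ^ r (a ∷ w) ⟧ (insertʳ x g) + r * absorb x (⟦Σ⟧ g) (a ∷ w) ∎
      where
      s = ⟦ Σ^ r w ⟧ (extend r a (λ v → g (x ∷ v)))
      t = ⟦ x ⋄ a ⟧ (λ c → ⟦Σ⟧ g (c ∷ w))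
      i = ⟦ Σ^ r w ⟧ (insertʳ x (extend r a g))
      u = absorb x (λ v → ⟦Σ⟧ g (a ∷ v)) w

      lead : ⟦Σ⟧ g (x ∷ a ∷ w) ≡ s + r * t
      lead = begin
        ⟦ Σ^ r (x ∷ a ∷ w) ⟧ g
          ≡⟨ trans (⟦Σ^⟧-∷ r x (a ∷ w) g) (⟦Σ^⟧-∷ r a w (extend r x g)) ⟩
        ⟦ Σ^ r w ⟧ (extend r a (extend r x g))
          ≡⟨ ⟦⟧-cong (Σ^ r w) (λ v → trans (extend-+ a (λ v → g (x ∷ v)) (λ v → r * merge x g v) v)
               (cong (extend r a (λ v → g (x ∷ v)) v +_)
                 (trans (extend-* a r (merge x g) v) (cong (r *_) (sym (extend-merge r x a g v)))))) ⟩
        ⟦ Σ^ r w ⟧ (λ v → extend r a (λ v → g (x ∷ v)) v + r * ⟦ x ⋄ a ⟧ (λ c → extend r c g v))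
          ≡⟨ trans (⟦⟧-+ (Σ^ r w) _ _) (cong (s +_) (⟦⟧-* (Σ^ r w) r _)) ⟩
        s + r * ⟦ Σ^ r w ⟧ (λ v → ⟦ x ⋄ a ⟧ (λ c → extend r c g v))
          ≡⟨ cong (λ z → s + r * z) (trans (⟦⟧-swap (Σ^ r w) (x ⋄ a) _)
               (⟦⟧-cong (x ⋄ a) (λ c → sym (⟦Σ^⟧-∷ r c w g)))) ⟩
        s + r * t ∎

    -- Recursions for the sums over permutations

    -- In the notation of the overview these are x * G(S), L(x;S) and G(xS), evaluated at the test
    -- function.
    mult last all : A → List A → (Word → ℚ) → ℚ
    mult x S g = ∑ (perms S) (⟦Σ⟧ (λ w → ⟦ (x ∷ []) ⊛ w ⟧ g))
    last x S g = ∑ (perms S) (⟦Σ⟧ (insertʳ x g))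
    all  x S g = ∑ (perms S) (insert x (⟦Σ⟧ g))

    pickSum : (A → List A → ℚ) → A → List A → ℚ
    pickSum Φ x S = ∑ (pick S) (λ (y , T) → ⟦ x ⋄ y ⟧ (λ c → Φ c T))

    last-absorb : ∀ x S g → ∑ (perms S) (⟦Σ⟧ (absorb x g)) ≡ pickSum (λ c T → last c T g) x S
    last-absorb x S g = begin
      ∑ (perms S) (⟦Σ⟧ (absorb x g))
        ≡⟨ ∑-cong (perms S) (λ w → ⟦Σ^⟧-absorb x w g) ⟩
      ∑ (perms S) (λ w → ∑ (places w) (λ (p , b , q) → ⟦ x ⋄ b ⟧ (λ c → insertAt p c q g)))
        ≡⟨ perms-places S (λ p b q → ⟦ x ⋄ b ⟧ (λ c → insertAt p c q g)) ⟩
      ∑ (pick S) (λ (y , T) → ∑ (perms T) (λ w → ∑ (cuts w) (λ (p , q) → ⟦ x ⋄ y ⟧ (λ c → insertAt p c q g))))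
        ≡⟨ ∑-cong (pick S) (λ (y , T) → trans (⟦⟧-∑ (x ⋄ y) (perms T) _)
             (∑-cong (perms T) (λ w → trans (⟦⟧-cong (x ⋄ y) (λ c → ⟦Σ^⟧-insertʳ c w g))
               (⟦⟧-∑ (x ⋄ y) (cuts w) _)))) ⟨
      pickSum (λ c T → last c T g) x S ∎

    all-absorb : ∀ x S g → ∑ (perms S) (absorb x (⟦Σ⟧ g)) ≡ pickSum (λ c T → all c T g) x S
    all-absorb x S g = begin
      ∑ (perms S) (absorb x (⟦Σ⟧ g))
        ≡⟨ perms-places S (λ p b q → ⟦ x ⋄ b ⟧ (λ c → ⟦Σ⟧ g (p ++ c ∷ q))) ⟩
      ∑ (pick S) (λ (y , T) → ∑ (perms T) (λ w → ∑ (cuts w) (λ (p , q) → ⟦ x ⋄ y ⟧ (λ c → ⟦Σ⟧ g (p ++ c ∷ q)))))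
        ≡⟨ ∑-cong (pick S) (λ (y , T) → trans (⟦⟧-∑ (x ⋄ y) (perms T) _)
             (∑-cong (perms T) (λ w → ⟦⟧-∑ (x ⋄ y) (cuts w) _))) ⟨
      pickSum (λ c T → all c T g) x S ∎

    -- `insertʳ` counts absorption with weight r and the quasi-shuffle product with weight 1; the
    -- difference r - 1 multiplies the remaining absorptions.
    last-rec : ∀ x S g →
      last x S g ≡ mult x S g + (r - 1ℚ) * pickSum (λ c T → last c T g) x S
    last-rec x S g = begin
      last x S g
        ≡⟨ ∑-cong (perms S) (λ w → trans (⟦⟧-cong (Σ^ r w) point) (trans (⟦⟧-+ (Σ^ r w) _ _)
             (cong (⟦Σ⟧ (λ w → ⟦ (x ∷ []) ⊛ w ⟧ g) w +_) (⟦⟧-* (Σ^ r w) (r - 1ℚ) _)))) ⟩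
      ∑ (perms S) (λ w → ⟦Σ⟧ (λ w → ⟦ (x ∷ []) ⊛ w ⟧ g) w + (r - 1ℚ) * ⟦Σ⟧ (absorb x g) w)
        ≡⟨ trans (∑-+ (perms S) _ _) (cong (mult x S g +_) (∑-* (perms S) (r - 1ℚ) _)) ⟩
      mult x S g + (r - 1ℚ) * ∑ (perms S) (⟦Σ⟧ (absorb x g))
        ≡⟨ cong (λ z → mult x S g + (r - 1ℚ) * z) (last-absorb x S g) ⟩
      mult x S g + (r - 1ℚ) * pickSum (λ c T → last c T g) x S ∎
      where
      point : ∀ w → insertʳ x g w ≡ ⟦ (x ∷ []) ⊛ w ⟧ g + (r - 1ℚ) * absorb x g w
      point w = trans
        (solve 3 (λ i b r → i :+ r :* b := (i :+ b) :+ (r :- con 1ℚ) :* b) refl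
          (insert x g w) (absorb x g w) r)
        (cong (_+ (r - 1ℚ) * absorb x g w) (sym (⊛≡insert+absorb x w g)))

    all-rec : ∀ x S g → all x S g ≡ last x S g + r * pickSum (λ c T → all c T g) x S
    all-rec x S g = begin
      all x S g
        ≡⟨ ∑-cong (perms S) (λ w → insert-⟦Σ^⟧ x w g) ⟩
      ∑ (perms S) (λ w → ⟦ Σ^ r w ⟧ (insertʳ x g) + r * absorb x (⟦Σ⟧ g) w)
        ≡⟨ trans (∑-+ (perms S) _ _) (cong (last x S g +_) (∑-* (perms S) r _)) ⟩
      last x S g + r * ∑ (perms S) (absorb x (⟦Σ⟧ g))
        ≡⟨ cong (λ z → last x S g + r * z) (all-absorb x S g) ⟩
      last x S g + r * pickSum (λ c T → all c T g) x S ∎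

    -- `pickSum` looks only at lists shorter by one, so the recursion determines its solution.
    pickSum-unique : ∀ (Φ F G : A → List A → ℚ) s →
      (∀ x S → F x S ≡ Φ x S + s * pickSum F x S) →
      (∀ x S → G x S ≡ Φ x S + s * pickSum G x S) →
      ∀ x S → F x S ≡ G x S
    pickSum-unique Φ F G s F-rec G-rec x S = go (length S) x S refl
      where
      go : ∀ n x S → length S ≡ n → F x S ≡ G x S
      step : ∀ n x S → length S ≡ n → pickSum F x S ≡ pickSum G x S
      go n x S e = trans (F-rec x S)
        (trans (cong (λ z → Φ x S + s * z) (step n x S e)) (sym (G-rec x S)))
      step zero    x [] e = refl
      step (suc n) x S  e = ∑-cong-All (pick S) (All.map
        (λ {(y , T)} e′ → ⟦⟧-cong (x ⋄ y) (λ c → go n c T (ℕ.suc-injective (trans e′ e))))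
        (pick-length S))

    pickSum-linear : ∀ a b F G x S →
      pickSum (λ c T → a * F c T + b * G c T) x S ≡ a * pickSum F x S + b * pickSum G x S
    pickSum-linear a b F G x S = begin
      pickSum (λ c T → a * F c T + b * G c T) x S
        ≡⟨ ∑-cong (pick S) (λ (y , T) → trans (⟦⟧-+ (x ⋄ y) _ _)
             (cong₂ _+_ (⟦⟧-* (x ⋄ y) a (λ c → F c T)) (⟦⟧-* (x ⋄ y) b (λ c → G c T)))) ⟩
      ∑ (pick S) (λ (y , T) → a * ⟦ x ⋄ y ⟧ (λ c → F c T) + b * ⟦ x ⋄ y ⟧ (λ c → G c T))
        ≡⟨ trans (∑-+ (pick S) _ _) (cong₂ _+_ (∑-* (pick S) a _) (∑-* (pick S) b _)) ⟩
      a * pickSum F x S + b * pickSum G x S ∎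

    fuse-cong : ∀ a bs {f g} → (∀ c → f c ≡ g c) → fuse a bs f ≡ fuse a bs g
    fuse-cong a []       e = e a
    fuse-cong a (b ∷ bs) e = ⟦⟧-cong (a ⋄ b) (λ c → fuse-cong c bs e)

    -- Whichever element of `T` is multiplied to `x` first, the product is the same by
    -- `⋄-rightComm`, and there are `length T` choices.
    fuse-pick : ∀ x T f →
      ℕtoℚ (length T) * fuse x T f ≡ ∑ (pick T) (λ (y , T′) → ⟦ x ⋄ y ⟧ (λ c → fuse c T′ f))
    fuse-pick x []      f = *-zeroˡ (f x)
    fuse-pick x (y ∷ T) f = begin
      ℕtoℚ (suc (length T)) * F
        ≡⟨ cong (_* F) (ℕtoℚ-suc (length T)) ⟩
      (1ℚ + ℕtoℚ (length T)) * F
        ≡⟨ solve 2 (λ n f → (con 1ℚ :+ n) :* f := f :+ n :* f) refl (ℕtoℚ (length T)) F ⟩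
      F + ℕtoℚ (length T) * F
        ≡⟨ cong (F +_) (⟦⟧-* (x ⋄ y) (ℕtoℚ (length T)) (λ c → fuse c T f)) ⟨
      F + ⟦ x ⋄ y ⟧ (λ c → ℕtoℚ (length T) * fuse c T f)
        ≡⟨ cong (F +_) (trans (⟦⟧-cong (x ⋄ y) (λ c → fuse-pick c T f)) (⟦⟧-∑ (x ⋄ y) (pick T) _)) ⟩
      F + ∑ (pick T) (λ (z , T′) → ⟦ x ⋄ y ⟧ (λ c → ⟦ c ⋄ z ⟧ (λ d → fuse d T′ f)))
        ≡⟨ cong (F +_) (∑-cong (pick T) (λ (z , T′) → ⋄-rightComm x y z (λ d → fuse d T′ f))) ⟩
      F + ∑ (pick T) (λ (z , T′) → ⟦ x ⋄ z ⟧ (λ c → fuse c (y ∷ T′) f))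
        ≡⟨ pick-∷ y T (λ z T′ → ⟦ x ⋄ z ⟧ (λ c → fuse c T′ f)) ⟨
      ∑ (pick (y ∷ T)) (λ (z , T′) → ⟦ x ⋄ z ⟧ (λ c → fuse c T′ f)) ∎
      where F = fuse x (y ∷ T) f

    -- The factorial counts the orders in which t letters are absorbed one after another, each at
    -- cost `s`.
    weight : ℚ → ℕ → ℚ
    weight s t = ℕtoℚ (t !) * (s ^ℚ t)

    weight-suc : ∀ s t → weight s (suc t) ≡ s * (ℕtoℚ (suc t) * weight s t)
    weight-suc s t = trans (cong (_* (s * (s ^ℚ t))) (ℕtoℚ-* (suc t) (t !)))
      (solve 4 (λ s n f p → (n :* f) :* (s :* p) := s :* (n :* (f :* p))) refl
        s (ℕtoℚ (suc t)) (ℕtoℚ (t !)) (s ^ℚ t))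

    weight-fuse : ∀ s x T f → weight s (length T) * fuse x T f ≡
      whenNil T (f x) + s * ∑ (pick T) (λ (y , T′) → weight s (length T′) * ⟦ x ⋄ y ⟧ (λ c → fuse c T′ f))
    weight-fuse s x []      f =
      solve 2 (λ y s → (con 1ℚ :* con 1ℚ) :* y := y :+ s :* con 0ℚ) refl (f x) s
    weight-fuse s x (y ∷ T) f = begin
      weight s (suc (length T)) * F
        ≡⟨ cong (_* F) (weight-suc s (length T)) ⟩
      s * (ℕtoℚ (suc (length T)) * w) * F
        ≡⟨ solve 4 (λ s n w f → s :* (n :* w) :* f := con 0ℚ :+ s :* (w :* (n :* f))) refl
             s (ℕtoℚ (suc (length T))) w F ⟩
      0ℚ + s * (w * (ℕtoℚ (suc (length T)) * F))
        ≡⟨ cong (λ z → 0ℚ + s * (w * z)) (fuse-pick x (y ∷ T) f) ⟩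
      0ℚ + s * (w * ∑ (pick (y ∷ T)) (λ (z , T′) → ⟦ x ⋄ z ⟧ (λ c → fuse c T′ f)))
        ≡⟨ cong (λ z → 0ℚ + s * z) (trans (sym (∑-* (pick (y ∷ T)) w _))
             (∑-cong-All (pick (y ∷ T)) (All.map
               (λ {(z , T′)} e → cong (λ n → weight s n * ⟦ x ⋄ z ⟧ (λ c → fuse c T′ f)) (sym (ℕ.suc-injective e)))
               (pick-length (y ∷ T))))) ⟩
      0ℚ + s * ∑ (pick (y ∷ T)) (λ (z , T′) → weight s (length T′) * ⟦ x ⋄ z ⟧ (λ c → fuse c T′ f)) ∎
      where
      F = fuse x (y ∷ T) f
      w = weight s (length T)

    -- The sum K_s of the overview, with an arbitrary Φ(c;U) in the place of c * G(U).
    fuseSum : ℚ → (A → List A → ℚ) → A → List A → ℚ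
    fuseSum s Φ x S = ∑ (splits S) (λ (T , U) → weight s (length T) * fuse x T (λ c → Φ c U))

    fuseSum-rec : ∀ s Φ x S → fuseSum s Φ x S ≡ Φ x S + s * pickSum (fuseSum s Φ) x S
    fuseSum-rec s Φ x S = begin
      fuseSum s Φ x S
        ≡⟨ ∑-cong (splits S) (λ (T , U) → weight-fuse s x T (λ c → Φ c U)) ⟩
      ∑ (splits S) (λ (T , U) → whenNil T (Φ x U) + s * ∑ (pick T) (λ (y , T′) → k y T′ U))
        ≡⟨ trans (∑-+ (splits S) _ _) (cong₂ _+_ (splits-nil S (Φ x)) (∑-* (splits S) s _)) ⟩
      Φ x S + s * ∑ (splits S) (λ (T , U) → ∑ (pick T) (λ (y , T′) → k y T′ U))
        ≡⟨ cong (λ z → Φ x S + s * z) (trans (splits-pick S k) (∑-cong (pick S) (λ (y , S′) →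
             sym (trans (⟦⟧-∑ (x ⋄ y) (splits S′) _)
               (∑-cong (splits S′) (λ (T , U) → ⟦⟧-* (x ⋄ y) (weight s (length T)) _)))))) ⟩
      Φ x S + s * pickSum (fuseSum s Φ) x S ∎
      where
      k : A → List A → List A → ℚ
      k y T U = weight s (length T) * ⟦ x ⋄ y ⟧ (λ c → fuse c T (λ c → Φ c U))

    last≡fuseSum : ∀ g x S →
      last x S g ≡ fuseSum (r - 1ℚ) (λ c U → mult c U g) x S
    last≡fuseSum g = pickSum-unique (λ c U → mult c U g) (λ x S → last x S g)
      (fuseSum (r - 1ℚ) (λ c U → mult c U g)) (r - 1ℚ)
      (λ x S → last-rec x S g) (fuseSum-rec (r - 1ℚ) (λ c U → mult c U g))

    -- The combination on the right satisfies `all-rec`: its coefficients r and 1 - r add up to 1,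
    -- so the `mult` term occurs once, as it does inside `last`.
    all≡fuseSum : ∀ g x S → all x S g ≡
      r * fuseSum r (λ c U → mult c U g) x S + (1ℚ - r) * fuseSum (r - 1ℚ) (λ c U → mult c U g) x S
    all≡fuseSum g = pickSum-unique (λ x S → last x S g) (λ x S → all x S g) G r
      (λ x S → all-rec x S g) G-rec
      where
      Φ : A → List A → ℚ
      Φ c U = mult c U g
      K L G : A → List A → ℚ
      K = fuseSum r Φ
      L = fuseSum (r - 1ℚ) Φ
      G x S = r * K x S + (1ℚ - r) * L x S

      G-rec : ∀ x S → G x S ≡ last x S g + r * pickSum G x S
      G-rec x S = begin
        r * K x S + (1ℚ - r) * L x S
          ≡⟨ cong₂ (λ k l → r * k + (1ℚ - r) * l) (fuseSum-rec r Φ x S) (fuseSum-rec (r - 1ℚ) Φ x S) ⟩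
        r * (m + r * k) + (1ℚ - r) * (m + (r - 1ℚ) * l)
          ≡⟨ solve 4 (λ r m k l →
               r :* (m :+ r :* k) :+ (con 1ℚ :- r) :* (m :+ (r :- con 1ℚ) :* l) :=
               (m :+ (r :- con 1ℚ) :* l) :+ r :* (r :* k :+ (con 1ℚ :- r) :* l)) refl r m k l ⟩
        (m + (r - 1ℚ) * l) + r * (r * k + (1ℚ - r) * l)
          ≡⟨ cong₂ (λ u v → u + r * v)
               (trans (last≡fuseSum g x S) (fuseSum-rec (r - 1ℚ) Φ x S))
               (pickSum-linear r (1ℚ - r) K L x S) ⟨
        last x S g + r * pickSum G x S ∎
        where
        m = Φ x S
        k = pickSum K x S
        l = pickSum L x S

    -- Weighted sums over set partitions

    blockWeight : ℕ → ℚ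
    blockWeight t = ((- 1ℚ) ^ℚ t) * (ℕtoℚ (t !) * pPoly (suc t) r)

    blockWeight-split : ∀ t → blockWeight t ≡ r * weight r t + (1ℚ - r) * weight (r - 1ℚ) t
    blockWeight-split t = begin
      e * (f * ((1ℚ - r) * x - (- r) * y))
        ≡⟨ solve 5 (λ e f r x y → e :* (f :* ((con 1ℚ :- r) :* x :- (:- r) :* y)) :=
             r :* (f :* (e :* y)) :+ (con 1ℚ :- r) :* (f :* (e :* x))) refl e f r x y ⟩
      r * (f * (e * y)) + (1ℚ - r) * (f * (e * x))
        ≡⟨ cong₂ (λ u v → r * (f * u) + (1ℚ - r) * (f * v))
             (trans (sym (^ℚ-distrib-* (- 1ℚ) (- r) t))
               (cong (_^ℚ t) (solve 1 (λ r → con (- 1ℚ) :* (:- r) := r) refl r)))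
             (trans (sym (^ℚ-distrib-* (- 1ℚ) (1ℚ - r) t))
               (cong (_^ℚ t) (solve 1 (λ r → con (- 1ℚ) :* (con 1ℚ :- r) := r :- con 1ℚ) refl r))) ⟩
      r * weight r t + (1ℚ - r) * weight (r - 1ℚ) t ∎
      where
      e = (- 1ℚ) ^ℚ t
      f = ℕtoℚ (t !)
      x = (1ℚ - r) ^ℚ t
      y = (- r) ^ℚ t

    -- The product here is the ordinary quasi-shuffle product, nested to the right; the interpolated
    -- one is recovered by the choice of `g`.
    blocks : List (List⁺ A) → (Word → ℚ) → ℚ
    blocks []      g = g []
    blocks (B ∷ P) g = blockWeight (length (List⁺.tail B))
      * ⟦ dia B ⟧ (λ c → blocks P (λ w → ⟦ (c ∷ []) ⊛ w ⟧ g))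

    blocks-cong : ∀ P {f g} → (∀ w → f w ≡ g w) → blocks P f ≡ blocks P g
    blocks-cong []      e = e []
    blocks-cong (B ∷ P) e = cong (blockWeight (length (List⁺.tail B)) *_)
      (⟦⟧-cong (dia B) (λ c → blocks-cong P (λ w → ⟦⟧-cong ((c ∷ []) ⊛ w) e)))

    blocks-swap : ∀ B B′ P g → blocks (B ∷ B′ ∷ P) g ≡ blocks (B′ ∷ B ∷ P) g
    blocks-swap B B′ P g = begin
      b * ⟦ dia B ⟧ (λ c → b′ * ⟦ dia B′ ⟧ (λ c′ → k c c′))
        ≡⟨ cong (b *_) (⟦⟧-* (dia B) b′ _) ⟩
      b * (b′ * ⟦ dia B ⟧ (λ c → ⟦ dia B′ ⟧ (λ c′ → k c c′)))
        ≡⟨ *-exchange b b′ _ ⟩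
      b′ * (b * ⟦ dia B ⟧ (λ c → ⟦ dia B′ ⟧ (λ c′ → k c c′)))
        ≡⟨ cong (λ z → b′ * (b * z)) (trans (⟦⟧-swap (dia B) (dia B′) k)
             (⟦⟧-cong (dia B′) (λ c′ → ⟦⟧-cong (dia B) (λ c → blocks-cong P (λ w → ⊛-leftComm c c′ w g))))) ⟩
      b′ * (b * ⟦ dia B′ ⟧ (λ c′ → ⟦ dia B ⟧ (λ c → k c′ c)))
        ≡⟨ cong (b′ *_) (⟦⟧-* (dia B′) b _) ⟨
      b′ * ⟦ dia B′ ⟧ (λ c′ → b * ⟦ dia B ⟧ (λ c → k c′ c)) ∎
      where
      b  = blockWeight (length (List⁺.tail B))
      b′ = blockWeight (length (List⁺.tail B′))
      k : A → A → ℚ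
      k c c′ = blocks P (λ w → ⟦ (c′ ∷ []) ⊛ w ⟧ (λ v → ⟦ (c ∷ []) ⊛ v ⟧ g))

    blocks-∑ : ∀ B (L : List X) (P : X → List (List⁺ A)) g →
      ∑ L (λ i → blocks (B ∷ P i) g) ≡
        blockWeight (length (List⁺.tail B)) * ⟦ dia B ⟧ (λ c → ∑ L (λ i → blocks (P i) (λ w → ⟦ (c ∷ []) ⊛ w ⟧ g)))
    blocks-∑ B L P g = trans (∑-* L (blockWeight (length (List⁺.tail B))) _)
      (cong (blockWeight (length (List⁺.tail B)) *_) (sym (⟦⟧-∑ (dia B) L _)))

    -- `inserts` leaves the enlarged block where it was; `blocks-swap` carries it to the front.
    blocks-inserts : ∀ x P g → ∑ (inserts x P) (λ P′ → blocks P′ g)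
      ≡ ∑ (pick P) (λ (B , P′) → blocks ((x ∷ List⁺.toList B) ∷ P′) g)
    blocks-inserts x []      g = refl
    blocks-inserts x (B ∷ P) g = begin
      ∑ (inserts x (B ∷ P)) (λ P′ → blocks P′ g)
        ≡⟨ inserts-∷ x B P (λ P′ → blocks P′ g) ⟩
      y + ∑ (inserts x P) (λ P′ → blocks (B ∷ P′) g)
        ≡⟨ cong (y +_) (trans (blocks-∑ B (inserts x P) (λ P′ → P′) g)
             (cong (blockWeight (length (List⁺.tail B)) *_)
               (⟦⟧-cong (dia B) (λ c → blocks-inserts x P (λ w → ⟦ (c ∷ []) ⊛ w ⟧ g))))) ⟩
      y + blockWeight (length (List⁺.tail B)) * ⟦ dia B ⟧ (λ c → ∑ (pick P)
            (λ (B′ , P′) → blocks ((x ∷ List⁺.toList B′) ∷ P′) (λ w → ⟦ (c ∷ []) ⊛ w ⟧ g)))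
        ≡⟨ cong (y +_) (blocks-∑ B (pick P) (λ (B′ , P′) → (x ∷ List⁺.toList B′) ∷ P′) g) ⟨
      y + ∑ (pick P) (λ (B′ , P′) → blocks (B ∷ (x ∷ List⁺.toList B′) ∷ P′) g)
        ≡⟨ cong (y +_) (∑-cong (pick P) (λ (B′ , P′) → blocks-swap B (x ∷ List⁺.toList B′) P′ g)) ⟩
      y + ∑ (pick P) (λ (B′ , P′) → blocks ((x ∷ List⁺.toList B′) ∷ B ∷ P′) g)
        ≡⟨ pick-∷ B P (λ B P′ → blocks ((x ∷ List⁺.toList B) ∷ P′) g) ⟨
      ∑ (pick (B ∷ P)) (λ (B , P′) → blocks ((x ∷ List⁺.toList B) ∷ P′) g) ∎
      where y = blocks ((x ∷ List⁺.toList B) ∷ P) g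

    partitionSum : List A → (Word → ℚ) → ℚ
    partitionSum S g = ∑ (partitions S) (λ P → blocks P g)

    partitionSum-∷ : ∀ x S g → partitionSum (x ∷ S) g ≡
      ∑ (splits S) (λ (T , U) → blockWeight (length T) * fuse x T (λ c → partitionSum U (λ w → ⟦ (c ∷ []) ⊛ w ⟧ g)))
    partitionSum-∷ x S g = begin
      partitionSum (x ∷ S) g
        ≡⟨ partitions-∷ x S (λ P → blocks P g) ⟩
      ∑ (partitions S) (λ P → blocks ((x ∷ []) ∷ P) g + ∑ (inserts x P) (λ P′ → blocks P′ g))
        ≡⟨ ∑-cong (partitions S) (λ P → cong (blocks ((x ∷ []) ∷ P) g +_) (blocks-inserts x P g)) ⟩
      -- The singleton block of `x` is the case of an empty marked block.
      ∑ (partitions S) (marked (λ T Q → blocks ((x ∷ T) ∷ Q) g))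
        ≡⟨ partitions-marked S (λ T Q → blocks ((x ∷ T) ∷ Q) g) ⟩
      ∑ (splits S) (λ (T , U) → ∑ (partitions U) (λ Q → blocks ((x ∷ T) ∷ Q) g))
        ≡⟨ ∑-cong (splits S) (λ (T , U) → trans (blocks-∑ (x ∷ T) (partitions U) (λ Q → Q) g)
             (cong (blockWeight (length T) *_) (⟦dia⟧ x T _))) ⟩
      ∑ (splits S) (λ (T , U) → blockWeight (length T) * fuse x T (λ c → partitionSum U (λ w → ⟦ (c ∷ []) ⊛ w ⟧ g))) ∎

    -- Splitting off the block of `x` leaves the same identity for the complement `U`, with `g`
    -- precomposed with multiplication by `c`; hence the induction over all `g`. Only a bound on the
    -- length of `U` is available, so it runs over a bound `n`.
    partitionSum≡perms : ∀ S g → partitionSum S g ≡ ∑ (perms S) (⟦Σ⟧ g)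
    partitionSum≡perms S g = go (length S) S g ℕ.≤-refl
      where
      go : ∀ n S g → length S ℕ.≤ n → partitionSum S g ≡ ∑ (perms S) (⟦Σ⟧ g)
      go n       []      g le = cong (_+ 0ℚ) (sym (⟦Σ^⟧-[] r g))
      go (suc n) (x ∷ S) g (s≤s le) = begin
        partitionSum (x ∷ S) g
          ≡⟨ partitionSum-∷ x S g ⟩
        ∑ (splits S) (λ (T , U) → blockWeight (length T) * fuse x T (λ c → partitionSum U (λ w → ⟦ (c ∷ []) ⊛ w ⟧ g)))
          ≡⟨ ∑-cong-All (splits S) (All.map (λ {(T , U)} le′ → cong (blockWeight (length T) *_)
               (fuse-cong x T (λ c → go n U (λ w → ⟦ (c ∷ []) ⊛ w ⟧ g) (ℕ.≤-trans le′ le)))) (splits-length S)) ⟩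
        ∑ (splits S) (λ (T , U) → blockWeight (length T) * fuse x T (λ c → Φ c U))
          ≡⟨ ∑-cong (splits S) (λ (T , U) → trans (cong (_* fuse x T (λ c → Φ c U)) (blockWeight-split (length T)))
               (solve 5 (λ a v b w f → (a :* v :+ b :* w) :* f := a :* (v :* f) :+ b :* (w :* f)) refl
                 r (weight r (length T)) (1ℚ - r) (weight (r - 1ℚ) (length T)) (fuse x T (λ c → Φ c U)))) ⟩
        ∑ (splits S) (λ (T , U) → r * (weight r (length T) * fuse x T (λ c → Φ c U))
          + (1ℚ - r) * (weight (r - 1ℚ) (length T) * fuse x T (λ c → Φ c U)))
          ≡⟨ trans (∑-+ (splits S) _ _) (cong₂ _+_ (∑-* (splits S) r _) (∑-* (splits S) (1ℚ - r) _)) ⟩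
        r * fuseSum r Φ x S + (1ℚ - r) * fuseSum (r - 1ℚ) Φ x S
          ≡⟨ all≡fuseSum g x S ⟨
        all x S g
          ≡⟨ ∑-perms-∷ x S (⟦Σ⟧ g) ⟨
        ∑ (perms (x ∷ S)) (⟦Σ⟧ g) ∎
        where
        Φ : A → List A → ℚ
        Φ c U = mult c U g

    -- Reduction of the interpolated product

    product : List (List⁺ A) → (Word → ℚ) → ℚ
    product []      g = g []
    product (B ∷ P) g = ⟦ dia B ⟧ (λ c → product P (λ w → ⟦ (c ∷ []) ⊛ w ⟧ g))

    product-cong : ∀ P {f g} → (∀ w → f w ≡ g w) → product P f ≡ product P g
    product-cong []      e = e []
    product-cong (B ∷ P) e =
      ⟦⟧-cong (dia B) (λ c → product-cong P (λ w → ⟦⟧-cong ((c ∷ []) ⊛ w) e))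

    -- The `Σ^ (- r)` that ends an inner product cancels the `Σ^ r` that begins the next one, and
    -- single letters are fixed by both; only the outermost `Σ^ (- r)` survives.
    ⟦interpProd⟧ : ∀ P g → ⟦ interpProd r (map (λ B → letterPoly (dia B)) P) ⟧ g
      ≡ product P (λ w → ⟦ Σ^ (- r) w ⟧ g)
    ⟦interpProd⟧ [] g = trans (+-identityʳ _) (trans (*-identityˡ (g [])) (sym (⟦Σ^⟧-[] (- r) g)))
    ⟦interpProd⟧ (B ∷ []) g = begin
      ⟦ letterPoly (dia B) ⟧ g
        ≡⟨ ∑-map _ (dia B) _ ⟩
      ⟦ dia B ⟧ (λ c → g (c ∷ []))
        ≡⟨ ⟦⟧-cong (dia B) (λ c → trans (⊛-[] c (λ w → ⟦ Σ^ (- r) w ⟧ g)) (⟦Σ^⟧-letter (- r) c g)) ⟨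
      product (B ∷ []) (λ w → ⟦ Σ^ (- r) w ⟧ g) ∎
    ⟦interpProd⟧ (B ∷ P@(_ ∷ _)) g = begin
      ⟦ interp r x y ⟧ g
        ≡⟨ ⟦Σ^ₚ⟧ (- r) (Σ^ₚ r x ⊛ₚ Σ^ₚ r y) g ⟩
      ⟦ Σ^ₚ r x ⊛ₚ Σ^ₚ r y ⟧ τ
        ≡⟨ trans (⟦⊛ₚ⟧ (Σ^ₚ r x) (Σ^ₚ r y) τ) (⟦Σ^ₚ⟧ r x K) ⟩
      ⟦ letterPoly (dia B) ⟧ (λ w → ⟦ Σ^ r w ⟧ K)
        ≡⟨ trans (∑-map _ (dia B) _) (⟦⟧-cong (dia B) (λ c → ⟦Σ^⟧-letter r c K)) ⟩
      ⟦ dia B ⟧ (λ c → ⟦ Σ^ₚ r y ⟧ (λ v → ⟦ (c ∷ []) ⊛ v ⟧ τ))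
        ≡⟨ ⟦⟧-cong (dia B) (λ c → trans (⟦Σ^ₚ⟧ r y (λ v → ⟦ (c ∷ []) ⊛ v ⟧ τ))
             (trans (⟦interpProd⟧ P (⟦Σ⟧ (λ v → ⟦ (c ∷ []) ⊛ v ⟧ τ)))
               (product-cong P (λ w → ⟦Σ^⟧-inverse (- r) r (+-inverseˡ r) w (λ v → ⟦ (c ∷ []) ⊛ v ⟧ τ))))) ⟩
      product (B ∷ P) τ ∎
      where
      x = letterPoly (dia B)
      y = interpProd r (map (λ B → letterPoly (dia B)) P)
      τ K : Word → ℚ
      τ w = ⟦ Σ^ (- r) w ⟧ g
      K w = ⟦ Σ^ₚ r y ⟧ (λ v → ⟦ w ⊛ v ⟧ τ)

    -- The exponent of the sign is the sum of card - 1 over the blocks, so the sign can be shared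
    -- out among the block weights.
    blocks-product : ∀ (u : X → A) P g →
      (((- 1ℚ) ^ℚ (size P ∸ length P))
        * foldr (λ Bm acc → ℕtoℚ ((List⁺.length Bm ∸ 1) !) * pPoly (List⁺.length Bm) r * acc) 1ℚ P)
        * product (map (List⁺.map u) P) g
      ≡ blocks (map (List⁺.map u) P) g
    blocks-product u []      g = trans (cong (_* g []) (*-identityˡ 1ℚ)) (*-identityˡ (g []))
    blocks-product u (B ∷ P) g = begin
      (((- 1ℚ) ^ℚ ((t ℕ.+ size P) ∸ length P)) * (f * p * F)) * ⟦ dia uB ⟧ k
        ≡⟨ cong (λ z → (z * (f * p * F)) * ⟦ dia uB ⟧ k) (trans
             (cong ((- 1ℚ) ^ℚ_) (ℕ.+-∸-assoc t (length≤size P))) (^ℚ-distribˡ-+-* (- 1ℚ) t (size P ∸ length P))) ⟩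
      ((s * s′) * (f * p * F)) * ⟦ dia uB ⟧ k
        ≡⟨ solve 6 (λ s s′ f p F z → ((s :* s′) :* (f :* p :* F)) :* z := (s :* (f :* p)) :* ((s′ :* F) :* z)) refl
             s s′ f p F (⟦ dia uB ⟧ k) ⟩
      blockWeight t * ((s′ * F) * ⟦ dia uB ⟧ k)
        ≡⟨ cong₂ (λ n z → blockWeight n * z) (sym (length-map u (List⁺.tail B)))
             (trans (sym (⟦⟧-* (dia uB) (s′ * F) k))
               (⟦⟧-cong (dia uB) (λ c → blocks-product u P (λ w → ⟦ (c ∷ []) ⊛ w ⟧ g)))) ⟩
      blocks (map (List⁺.map u) (B ∷ P)) g ∎
      where
      uB = List⁺.map u B
      t = length (List⁺.tail B)
      s = (- 1ℚ) ^ℚ t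
      s′ = (- 1ℚ) ^ℚ (size P ∸ length P)
      f = ℕtoℚ (t !)
      p = pPoly (suc t) r
      F = foldr (λ Bm acc → ℕtoℚ ((List⁺.length Bm ∸ 1) !) * pPoly (List⁺.length Bm) r * acc) 1ℚ P
      k : A → ℚ
      k c = product (map (List⁺.map u) P) (λ w → ⟦ (c ∷ []) ⊛ w ⟧ g)

    -- The two sides of the identity

    module _ (n : ℕ) (u : Fin n → A) where

      open Sides _⋄_ r n u

      ⟦lhs⟧ : ∀ g → ⟦ lhs ⟧ g ≡ ∑ (perms (map u (allFin n))) g
      ⟦lhs⟧ g = begin
        ⟦ lhs ⟧ g
          ≡⟨ ∑-map _ (Sym n) _ ⟩
        ∑ (Sym n) (λ σ → 1ℚ * g (map u (toList σ)))
          ≡⟨ ∑-cong (Sym n) (λ σ → *-identityˡ (g (map u (toList σ)))) ⟩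
        ∑ (Sym n) (λ σ → g (map u (toList σ)))
          ≡⟨ ∑-Sym n (λ w → g (map u w)) ⟩
        ∑ (perms (allFin n)) (λ w → g (map u w))
          ≡⟨ perms-map u (allFin n) g ⟩
        ∑ (perms (map u (allFin n))) g ∎

      ⟦rhs⟧ : ∀ g → ⟦ rhs ⟧ g ≡ partitionSum (map u (allFin n)) (λ w → ⟦ Σ^ (- r) w ⟧ g)
      ⟦rhs⟧ g = begin
        ⟦ rhs ⟧ g
          ≡⟨ ∑-concatMap _ (Π n) _ ⟩
        ∑ (Π n) (λ P → ⟦ scale (cr r n P) (interpProd r (map uB P)) ⟧ g)
          ≡⟨ ∑-cong-All (Π n) (All.map (λ {P} e → term P (trans e (length-tabulate (λ i → i)))) (partitions-size (allFin n))) ⟩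
        ∑ (Π n) (λ P → blocks (map (List⁺.map u) P) τ)
          ≡⟨ partitions-map u (allFin n) (λ P → blocks P τ) ⟩
        partitionSum (map u (allFin n)) τ ∎
        where
        τ : Word → ℚ
        τ w = ⟦ Σ^ (- r) w ⟧ g

        term : ∀ P → size P ≡ n →
          ⟦ scale (cr r n P) (interpProd r (map uB P)) ⟧ g ≡ blocks (map (List⁺.map u) P) τ
        term P e = begin
          ⟦ scale (cr r n P) (interpProd r (map uB P)) ⟧ g
            ≡⟨ ⟦⟧-scale (cr r n P) (interpProd r (map uB P)) g ⟩
          cr r n P * ⟦ interpProd r (map uB P) ⟧ g
            ≡⟨ cong (λ Q → cr r n P * ⟦ interpProd r Q ⟧ g) (map-∘ P) ⟩
          cr r n P * ⟦ interpProd r (map (λ B → letterPoly (dia B)) (map (List⁺.map u) P)) ⟧ g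
            ≡⟨ cong (cr r n P *_) (⟦interpProd⟧ (map (List⁺.map u) P) g) ⟩
          cr r n P * product (map (List⁺.map u) P) τ
            -- Writing `n` as `size P` gives the exponent a form that follows the blocks.
            ≡⟨ cong (λ m → (((- 1ℚ) ^ℚ (m ∸ length P))
                 * foldr (λ Bm acc → ℕtoℚ ((List⁺.length Bm ∸ 1) !) * pPoly (List⁺.length Bm) r * acc) 1ℚ P)
                 * product (map (List⁺.map u) P) τ) e ⟨
          _ ≡⟨ blocks-product u P τ ⟩
          blocks (map (List⁺.map u) P) τ ∎

      lhs≡rhs : ∀ g → ⟦ lhs ⟧ g ≡ ⟦ rhs ⟧ g
      lhs≡rhs g = begin
        ⟦ lhs ⟧ g
          ≡⟨ ⟦lhs⟧ g ⟩
        ∑ (perms (map u (allFin n))) g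
          ≡⟨ ∑-cong (perms (map u (allFin n))) (λ w → ⟦Σ^⟧-inverse r (- r) (+-inverseʳ r) w g) ⟨
        ∑ (perms (map u (allFin n))) (⟦Σ⟧ (λ w → ⟦ Σ^ (- r) w ⟧ g))
          ≡⟨ partitionSum≡perms (map u (allFin n)) (λ w → ⟦ Σ^ (- r) w ⟧ g) ⟨
        partitionSum (map u (allFin n)) (λ w → ⟦ Σ^ (- r) w ⟧ g)
          ≡⟨ ⟦rhs⟧ g ⟨
        ⟦ rhs ⟧ g ∎

theorem13 : (A : Set) (enc : A → ℕ) (inj : Injective _≡_ _≡_ enc)
    (_⋄_ : A → A → Lin A)
    → (∀ p q → Ops._⋄ₗ_ _⋄_ p q ≈⟨ countableDec enc inj ⟩ Ops._⋄ₗ_ _⋄_ q p)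
    → (∀ p q s → Ops._⋄ₗ_ _⋄_ (Ops._⋄ₗ_ _⋄_ p q) s ≈⟨ countableDec enc inj ⟩ Ops._⋄ₗ_ _⋄_ p (Ops._⋄ₗ_ _⋄_ q s))
    → (r : ℚ) (n : ℕ) (u : Fin n → A)
    → Sides.lhs _⋄_ r n u ≈⟨ ≡-dec (countableDec enc inj) ⟩ Sides.rhs _⋄_ r n u
theorem13 A enc inj _⋄_ ⋄ₗ-comm ⋄ₗ-assoc r n u =
  ⟦⟧⇒≈ (≡-dec (countableDec enc inj)) (Sides.lhs _⋄_ r n u) (Sides.rhs _⋄_ r n u)
    (Commutative.Interpolated.lhs≡rhs _⋄_ ⋄-comm ⋄-assoc r n u)
  where
  open Ops _⋄_
  open Products _⋄_

  ⟦letter⋄letter⟧ : ∀ a b g → ⟦ letter a ⋄ₗ letter b ⟧ g ≡ ⟦ a ⋄ b ⟧ g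
  ⟦letter⋄letter⟧ a b g = trans (⟦⋄ₗ⟧ (letter a) (letter b) g)
    (trans (⟦letter⟧ a (λ a → ⟦ letter b ⟧ (λ b → ⟦ a ⋄ b ⟧ g))) (⟦letter⟧ b (λ b → ⟦ a ⋄ b ⟧ g)))

  -- The hypothesis on coefficients is specialised to letters and turned into an equality of
  -- functionals by `≈⇒⟦⟧`.
  ⋄-comm : ∀ a b g → ⟦ a ⋄ b ⟧ g ≡ ⟦ b ⋄ a ⟧ g
  ⋄-comm a b g = begin
    ⟦ a ⋄ b ⟧ g                ≡⟨ ⟦letter⋄letter⟧ a b g ⟨
    ⟦ letter a ⋄ₗ letter b ⟧ g  ≡⟨ ≈⇒⟦⟧ (countableDec enc inj) (letter a ⋄ₗ letter b) (letter b ⋄ₗ letter a)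
                                     (⋄ₗ-comm (letter a) (letter b)) g ⟩
    ⟦ letter b ⋄ₗ letter a ⟧ g  ≡⟨ ⟦letter⋄letter⟧ b a g ⟩
    ⟦ b ⋄ a ⟧ g                ∎

  ⋄-assoc : ∀ a b c g → ⟦ a ⋄ b ⟧ (λ x → ⟦ x ⋄ c ⟧ g) ≡ ⟦ b ⋄ c ⟧ (λ x → ⟦ a ⋄ x ⟧ g)
  ⋄-assoc a b c g = begin
    ⟦ a ⋄ b ⟧ (λ x → ⟦ x ⋄ c ⟧ g)
      ≡⟨ ⟦letter⋄letter⟧ a b (λ x → ⟦ x ⋄ c ⟧ g) ⟨
    ⟦ letter a ⋄ₗ letter b ⟧ (λ x → ⟦ x ⋄ c ⟧ g)
      ≡⟨ trans (⟦⋄ₗ⟧ (letter a ⋄ₗ letter b) (letter c) g)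
           (⟦⟧-cong (letter a ⋄ₗ letter b) (λ x → ⟦letter⟧ c (λ c → ⟦ x ⋄ c ⟧ g))) ⟨
    ⟦ (letter a ⋄ₗ letter b) ⋄ₗ letter c ⟧ g
      ≡⟨ ≈⇒⟦⟧ (countableDec enc inj) ((letter a ⋄ₗ letter b) ⋄ₗ letter c) (letter a ⋄ₗ (letter b ⋄ₗ letter c))
           (⋄ₗ-assoc (letter a) (letter b) (letter c)) g ⟩
    ⟦ letter a ⋄ₗ (letter b ⋄ₗ letter c) ⟧ g
      ≡⟨ trans (⟦⋄ₗ⟧ (letter a) (letter b ⋄ₗ letter c) g)
           (⟦letter⟧ a (λ a → ⟦ letter b ⋄ₗ letter c ⟧ (λ x → ⟦ a ⋄ x ⟧ g))) ⟩
    ⟦ letter b ⋄ₗ letter c ⟧ (λ x → ⟦ a ⋄ x ⟧ g)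
      ≡⟨ ⟦letter⋄letter⟧ b c (λ x → ⟦ a ⋄ x ⟧ g) ⟩
    ⟦ b ⋄ c ⟧ (λ x → ⟦ a ⋄ x ⟧ g) ∎
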